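{- Let $k$ be a field and $n\ge3$. For every $i$ with $0\le i\le n-1$, the field $L_{\mathbf s}L_{\mathbf t}$ is generated over $K$ by all conjugates of $u_i$: $L_{\mathbf s}L_{\mathbf t}=K(u_i^g\mid \overline g\in H\backslash G_{\mathbf s,\mathbf t})$.
   Context: Let $x_1,\ldots,x_n,y_1,\ldots,y_n$ be independent variables over $k$; let $s_i$ (resp. $t_i$) be the $i$-th elementary symmetric function of $\mathbf x=(x_1,\ldots,x_n)$ (resp. $\mathbf y=(y_1,\ldots,y_n)$). Put $K=k(s_1,\ldots,s_n,t_1,\ldots,t_n)$, $L_{\mathbf s}=K(x_1,\ldots,x_n)$, $L_{\mathbf t}=K(y_1,\ldots,y_n)$, so $L_{\mathbf s}L_{\mathbf t}=k(\mathbf x,\mathbf y)$. Let $G_{\mathbf s,\mathbf t}=\mathrm{Gal}(k(\mathbf x,\mathbf y)/K)\cong\mathfrak S_n\times\mathfrak S_n$, which acts by permuting the $x_i$ and, independently, the $y_i$; the action is written on the right, $a\mapsto a^g$, with $a^{gh}=(a^g)^h$. Let $H\subset G_{\mathbf s,\mathbf t}$ be the diagonal subgroup of those $g$ for which there is $\pi\in\mathfrak S_n$ with $x_i^g=x_{\pi(i)}$ and $y_i^g=y_{\pi(i)}$ for all $i$. Define $u_0,\ldots,u_{n-1}\in k(\mathbf x,\mathbf y)$ as the unique solution of the system $y_i=u_0+u_1x_i+\cdots+u_{n-1}x_i^{n-1}$ ($i=1,\ldots,n$). Each $u_i$ is fixed by $H$, so $u_i^g$ depends only on the right coset $\overline g=Hg$.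 -}

module Defs where

open import Level using (Level; _⊔_; suc)
open import Data.Nat.Base as ℕ using (ℕ)
open import Data.Fin.Base using (Fin; toℕ; _↑ˡ_; _↑ʳ_)
open import Data.Fin.Permutation using (Permutation′; _⟨$⟩ʳ_)
open import Data.List.Base using (List; []; _∷_; [_]; map; foldr; _++_; tabulate)
open import Data.List.Relation.Unary.All using (All)
open import Data.List.Relation.Unary.Unique.Propositional using (Unique)
open import Data.Product.Base using (_×_; proj₁; proj₂; ∃-syntax; Σ-syntax)
open import Data.Vec.Base using (Vec; lookup)
open import Data.Vec.Functional using (Vector)
open import Relation.Nullary.Negation.Core using (¬_)
open import Relation.Unary using (Pred; _∈_; _∪_)
open import Algebra.Bundles using (CommutativeRing; Semiring)
open import Algebra.Morphism.Structures using (IsRingHomomorphism; IsRingIsomorphism)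
import Algebra.Definitions.RawSemiring as RawSemiringDefinitions

-- Neither decidable equality nor an apartness relation is required.
record Field (c ℓ : Level) : Set (suc (c ⊔ ℓ)) where
  field
    commutativeRing : CommutativeRing c ℓ

  open CommutativeRing commutativeRing public

  field
    0≉1        : ¬ (0# ≈ 1#)
    invertible : ∀ a → ¬ (a ≈ 0#) → ∃[ b ] a * b ≈ 1#

  open RawSemiringDefinitions (Semiring.rawSemiring semiring) public using (_^_; sum; product)

-- The sublists of length j, i.e. the j-element subsets of positions.
combinations : ∀ {a} {A : Set a} → ℕ → List A → List (List A)
combinations ℕ.zero    _        = [ [] ]
combinations (ℕ.suc j) []       = []
combinations (ℕ.suc j) (a ∷ as) =
  map (a ∷_) (combinations j as) ++ combinations (ℕ.suc j) as

module _ {c ℓ} (L : Field c ℓ) where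
  open Field L

  -- The j-th elementary symmetric function of z₁, …, zₘ.
  elementary : ∀ {m} → ℕ → Vector Carrier m → Carrier
  elementary j z =
    foldr _+_ 0# (map (foldr _*_ 1#) (combinations j (tabulate z)))

  Values : ∀ {i} {I : Set i} → (I → Carrier) → Pred Carrier (i ⊔ ℓ)
  Values f a = ∃[ i ] a ≈ f i

  -- The smallest subfield of L containing S.
  data Generated {p} (S : Pred Carrier p) : Pred Carrier (c ⊔ ℓ ⊔ p) where
    generator   : ∀ {a} → a ∈ S → Generated S a
    ≈-closed    : ∀ {a b} → a ≈ b → Generated S a → Generated S b
    zero-closed : Generated S 0#
    one-closed  : Generated S 1#
    add-closed  : ∀ {a b} → Generated S a → Generated S b → Generated S (a + b)
    mul-closed  : ∀ {a b} → Generated S a → Generated S b → Generated S (a * b)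
    neg-closed  : ∀ {a} → Generated S a → Generated S (- a)
    inv-closed  : ∀ {a b} → Generated S a → a * b ≈ 1# → Generated S b

  -- F(S).  For subfields F and F′, Adjoin F F′ is their compositum FF′.
  Adjoin : ∀ {p q} → Pred Carrier p → Pred Carrier q → Pred Carrier (c ⊔ ℓ ⊔ p ⊔ q)
  Adjoin F S = Generated (F ∪ S)

  -- An element of Gal(L/F).
  record Gal {p} (F : Pred Carrier p) : Set (c ⊔ ℓ ⊔ p) where
    field
      apply          : Carrier → Carrier
      isAutomorphism : IsRingIsomorphism rawRing rawRing apply
      fixes          : ∀ {a} → a ∈ F → apply a ≈ a

module _ {c ℓ c′ ℓ′} (k : Field c ℓ) (L : Field c′ ℓ′)
         (ι : Field.Carrier k → Field.Carrier L) where
  private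
    module k = Field k
  open Field L

  -- A polynomial in m variables over k, as a list of terms (coefficient,
  -- exponent vector); it is evaluated at z through ι.
  Terms : ℕ → Set c
  Terms m = List (k.Carrier × Vec ℕ m)

  monomial : ∀ {m} → Vector Carrier m → Vec ℕ m → Carrier
  monomial z α = product λ i → z i ^ lookup α i

  evaluate : ∀ {m} → Vector Carrier m → Terms m → Carrier
  evaluate z p = foldr _+_ 0# (map (λ t → ι (proj₁ t) * monomial z (proj₂ t)) p)

  -- Uniqueness of the exponent vectors is what makes "all coefficients vanish"
  -- mean "p is the zero polynomial".
  AlgebraicallyIndependent : ∀ {m} → Vector Carrier m → Set (c ⊔ ℓ ⊔ ℓ′)
  AlgebraicallyIndependent {m} z =
    (p : Terms m) → Unique (map proj₂ p) → evaluate z p ≈ 0# →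
    All (λ t → proj₁ t k.≈ k.0#) p

-- A realisation of k(z₁, …, zₘ), the zᵢ being independent variables over k.
-- These conditions determine the field and the zᵢ up to a unique
-- k-isomorphism, so a statement about all realisations is a statement about
-- the rational function field.
record RationalFunctionField {c ℓ} (k : Field c ℓ) (m : ℕ) (c′ ℓ′ : Level)
       : Set (c ⊔ ℓ ⊔ suc (c′ ⊔ ℓ′)) where
  field
    L : Field c′ ℓ′

  open Field L public

  field
    ι              : Field.Carrier k → Carrier
    ι-homomorphism : IsRingHomomorphism (Field.rawRing k) rawRing ι
    variables      : Vector Carrier m
    independent    : AlgebraicallyIndependent k L ι variables
    generated      : ∀ a → a ∈ Adjoin L (Values L ι) (Values L variables)

module TwoSets {c ℓ c′ ℓ′} {k : Field c ℓ} (n : ℕ)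
               (E : RationalFunctionField k (n ℕ.+ n) c′ ℓ′) where
  open RationalFunctionField E

  x y : Vector Carrier n
  x i = variables (i ↑ˡ n)
  y i = variables (n ↑ʳ i)

  -- s i and t i are the elementary symmetric functions of degree toℕ i + 1.
  s t : Vector Carrier n
  s i = elementary L (ℕ.suc (toℕ i)) x
  t i = elementary L (ℕ.suc (toℕ i)) y

  K Lₛ Lₜ LₛLₜ : Pred Carrier (c ⊔ c′ ⊔ ℓ′)
  K    = Adjoin L (Values L ι) (Values L s ∪ Values L t)
  Lₛ   = Adjoin L K (Values L x)
  Lₜ   = Adjoin L K (Values L y)
  LₛLₜ = Adjoin L Lₛ Lₜ

  G : Set (c ⊔ c′ ⊔ ℓ′)
  G = Gal L K

  infixl 8 _^ᴳ_
  _^ᴳ_ : Carrier → G → Carrier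
  a ^ᴳ g = Gal.apply g a

  H : Pred G ℓ′
  H g = Σ[ π ∈ Permutation′ n ]
          (∀ i → x i ^ᴳ g ≈ x (π ⟨$⟩ʳ i) × y i ^ᴳ g ≈ y (π ⟨$⟩ʳ i))

  -- The right coset Hg, a subset of G: g′ = hg for some h ∈ H, where
  -- a^(hg) = (a^h)^g.
  Coset : G → Pred G (c ⊔ c′ ⊔ ℓ′)
  Coset g g′ = ∃[ h ] h ∈ H × (∀ a → a ^ᴳ g′ ≈ (a ^ᴳ h) ^ᴳ g)

  -- The conjugates a^ḡ with ḡ ∈ H\G: b is the conjugate attached to Hg when it
  -- is the common value of a^g′ for g′ ∈ Hg.  Such a value exists for every
  -- coset as soon as a is fixed by H.
  Conjugates : Carrier → Pred Carrier (c ⊔ c′ ⊔ ℓ′)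
  Conjugates a b = ∃[ g ] (∀ g′ → g′ ∈ Coset g → b ≈ a ^ᴳ g′)

  -- The linear system defining u₀, …, uₙ₋₁; its matrix is the Vandermonde
  -- matrix of the pairwise distinct xᵢ, so it has exactly one solution.
  SolvesSystem : Vector Carrier n → Set ℓ′
  SolvesSystem u = ∀ i → y i ≈ sum λ j → u j * x i ^ toℕ j

{-# OPTIONS --safe #-}

-- Let F = K(uᵢᵍ | g).  Lagrange interpolation gives uᵢ = Σₗ yₗ Cₗ, where Cₗ is
-- the coefficient of Xⁱ in the l-th Lagrange polynomial of x₁, …, xₙ.  Permuting
-- the yₗ alone and subtracting puts every (yₐ - y_b)(Cⱼ - Cₖ) into F.
--
-- The Cₗ are distinct.  Fix D = Cⱼ - Cₖ with j ≠ k and let δₐ = ∏_{b ≠ a} (y_b - yₐ).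
-- Then Dⁿ⁻¹δₐ ∈ F, while Σₐ δₐ is a nonzero element of K, so that Dⁿ⁻¹ and all δₐ
-- lie in F.  Since δₐ is a polynomial over K in yₐ and the δₐ are distinct, yₐ can
-- be recovered from them: Σₐ yₐ q(δₐ) ∈ F for every q ∈ F[X], and one takes for q
-- the polynomial whose roots are all δ's but one.  Now Cⱼ - Cₖ ∈ F, then Cₗ ∈ F by
-- uᵢ = Σₗ yₗ Cₗ, and the same argument with the Cₗ in place of the δₐ yields xₗ ∈ F.
--
-- The elements of G used here extend permutations of the variables, by writing each
-- element of the field as a fraction of polynomial expressions.
module Submission where

open import Defs
open import Level using (_⊔_)
open import Data.Bool.Base using (if_then_else_)
open import Data.Fin.Base using (Fin; zero; suc; toℕ; fromℕ<; punchIn; punchOut; _↑ˡ_; _↑ʳ_; splitAt; join)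
open import Data.Fin.Permutation as Perm using (Permutation′; _⟨$⟩ʳ_)
open import Data.Fin.Properties as Fin using (punchInᵢ≢i; punchIn-punchOut; suc-injective; splitAt-↑ˡ; splitAt-↑ʳ; join-splitAt; toℕ-fromℕ<; +↔⊎)
open import Data.List.Base using (List; []; _∷_; _++_; foldr; map; tabulate)
open import Data.List.Relation.Unary.All using (All; []; _∷_)
open import Data.List.Relation.Unary.AllPairs using ([]; _∷_)
open import Data.List.Relation.Unary.Unique.Propositional using (Unique)
open import Data.Maybe.Base using (Maybe; just; nothing)
open import Data.Nat.Base as ℕ using (ℕ; zero; suc; _≤_; _<_; z≤n; s≤s)
import Data.Nat.Properties as ℕ
open import Data.Product.Base using (_×_; _,_; proj₁; proj₂; ∃-syntax)
open import Data.Sum.Base as Sum using (inj₁; inj₂; [_,_]′)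
open import Data.Sum.Function.Propositional using (_⊎-↔_)
open import Data.Vec.Base as Vec using (Vec)
open import Data.Vec.Functional using (Vector; removeAt; head; tail)
open import Data.Vec.Properties using (≡-dec)
open import Function.Base using (_∘_; id)
open import Function.Bundles using (Injection)
open import Function.Construct.Composition using (_↔-∘_)
open import Function.Construct.Symmetry using (↔-sym)
open import Function.Properties.Inverse using (↔⇒↣)
open import Relation.Binary.PropositionalEquality as ≡ using (_≡_; _≢_)
open import Relation.Nullary using (yes; no; does)
open import Relation.Nullary.Decidable using (dec-true; dec-false)
open import Relation.Unary using (Pred; _∈_; _∪_; _⊆_; _≐_)
open import Algebra.Bundles using (RawRing)
open import Algebra.Morphism.Structures using (IsRingHomomorphism; IsRingIsomorphism)
open import Algebra.Solver.Ring.AlmostCommutativeRing using (fromCommutativeRing; _-Raw-AlmostCommutative⟶_)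
import Algebra.Morphism.Construct.Composition as Composition
import Algebra.Properties.CommutativeSemigroup as CommutativeSemigroupProperties
import Algebra.Properties.Ring as RingProperties
import Algebra.Properties.Semiring.Mult as SemiringMult
import Algebra.Properties.Semiring.Sum as SemiringSum
import Algebra.Solver.Ring as RingSolver
import Algebra.Solver.Ring.NaturalCoefficients.Default as SemiringSolver
import Relation.Binary.Reasoning.Setoid as SetoidReasoning

-- The argument avoids the Galois correspondence: every membership in F is exhibited by field
-- operations, with division only by elements already shown to be nonzero. The obstacle is that the
-- differences arrive only as products (yₐ - y_b)D, with D itself unknown. Multiplying n - 1 of them
-- with the same D leaves one unknown factor Dⁿ⁻¹ common to all a, and summing over a isolates it.
-- Nonvanishing of expressions in the x or in the y is traced back to specialising the variables to
-- a vector with one entry 1 and all others 0. At such a point every δ_b with b other than the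
-- marked index has a vanishing factor, coming from a third index. For n = 2 this breaks down: there
-- δ₁ + δ₂ = 0. Sums Σₐ φ(yₐ) are placed in F by an induction that never divides by an integer, so
-- the argument is uniform in the characteristic.

-- Ring identities with integer coefficients.

module FieldProperties {c ℓ} (L : Field c ℓ) where
  open Field L hiding (zero)
  open RingProperties ring
  open CommutativeSemigroupProperties +-commutativeSemigroup using (interchange)
  open SemiringMult semiring using (×-homo-+; ×1-homo-*) renaming (_×_ to _times_)
  open SetoidReasoning setoid

  natural : ℕ → Carrier
  natural m = m times 1#

  private
    -- The pair (a , b) stands for the integer a - b; this makes the solver
    -- recognise x - x ≈ 0#, for which decidability of _≈_ is not available.
    differences : RawRing _ _
    differences = record
      { Carrier = ℕ × ℕ
      ; _≈_     = _≡_
      ; _+_     = λ (a , b) (a′ , b′) → a ℕ.+ a′ , b ℕ.+ b′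
      ; _*_     = λ (a , b) (a′ , b′) → a ℕ.* a′ ℕ.+ b ℕ.* b′ , a ℕ.* b′ ℕ.+ b ℕ.* a′
      ; -_      = λ (a , b) → b , a
      ; 0#      = 0 , 0
      ; 1#      = 1 , 0
      }

    difference : ℕ × ℕ → Carrier
    difference (a , b) = natural a - natural b

    difference-+ : ∀ p q → difference (RawRing._+_ differences p q) ≈ difference p + difference q
    difference-+ (a , b) (a′ , b′) = begin
      natural (a ℕ.+ a′) - natural (b ℕ.+ b′)                     ≈⟨ +-cong (×-homo-+ 1# a a′) (-‿cong (×-homo-+ 1# b b′)) ⟩
      (natural a + natural a′) - (natural b + natural b′)         ≈⟨ +-congˡ (-‿+-comm _ _) ⟨
      (natural a + natural a′) + (- natural b + - natural b′)     ≈⟨ interchange _ _ _ _ ⟩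
      (natural a - natural b) + (natural a′ - natural b′)         ∎

    natural-bilinear : ∀ a a′ b b′ →
      natural (a ℕ.* a′ ℕ.+ b ℕ.* b′) ≈ natural a * natural a′ + natural b * natural b′
    natural-bilinear a a′ b b′ = trans (×-homo-+ 1# (a ℕ.* a′) (b ℕ.* b′)) (+-cong (×1-homo-* a a′) (×1-homo-* b b′))

    difference-* : ∀ p q → difference (RawRing._*_ differences p q) ≈ difference p * difference q
    difference-* (m , n) (m′ , n′) = sym (begin
      (a - b) * (a′ - b′)                                     ≈⟨ expand a (- b) a′ (- b′) ⟩
      (a * a′ + - b * - b′) + (a * - b′ + - b * a′)           ≈⟨ +-cong (+-congˡ -b*-b′≈b*b′) (+-cong (sym (-‿distribʳ-* a b′)) (sym (-‿distribˡ-* b a′))) ⟩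
      (a * a′ + b * b′) + (- (a * b′) + - (b * a′))           ≈⟨ +-congˡ (-‿+-comm _ _) ⟩
      (a * a′ + b * b′) - (a * b′ + b * a′)                   ≈⟨ +-cong (natural-bilinear m m′ n n′) (-‿cong (natural-bilinear m n′ n m′)) ⟨
      difference (RawRing._*_ differences (m , n) (m′ , n′))  ∎)
      where
      a = natural m
      b = natural n
      a′ = natural m′
      b′ = natural n′
      -b*-b′≈b*b′ : - b * - b′ ≈ b * b′
      -b*-b′≈b*b′ = trans (sym (-‿distribˡ-* b (- b′))) (trans (-‿cong (sym (-‿distribʳ-* b b′))) (-‿involutive _))
      open SemiringSolver commutativeSemiring
      expand : ∀ p q p′ q′ → (p + q) * (p′ + q′) ≈ (p * p′ + q * q′) + (p * q′ + q * p′)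
      expand = solve 4 (λ p q p′ q′ → (p :+ q) :* (p′ :+ q′) := (p :* p′ :+ q :* q′) :+ (p :* q′ :+ q :* p′)) refl

    difference-neg : ∀ p → difference (RawRing.-_ differences p) ≈ - difference p
    difference-neg (a , b) = begin
      natural b - natural a          ≈⟨ +-comm _ _ ⟩
      - natural a + natural b        ≈⟨ +-congˡ (-‿involutive _) ⟨
      - natural a + - - natural b    ≈⟨ -‿+-comm _ _ ⟩
      - (natural a - natural b)      ∎

    difference-homomorphism : differences -Raw-AlmostCommutative⟶ fromCommutativeRing commutativeRing
    difference-homomorphism = record
      { ⟦_⟧    = difference
      ; +-homo = difference-+
      ; *-homo = difference-*
      ; -‿homo = difference-neg
      ; 0-homo = -‿inverseʳ 0#
      ; 1-homo = trans (+-cong (+-identityʳ 1#) -0#≈0#) (+-identityʳ 1#)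
      }

    difference-≟ : ∀ p q → Maybe (difference p ≈ difference q)
    difference-≟ (a , b) (a′ , b′) with a ℕ.+ b′ ℕ.≟ a′ ℕ.+ b
    ... | no _ = nothing
    ... | yes eq = just (begin
      natural a - natural b                                   ≈⟨ +-identityʳ _ ⟨
      (natural a - natural b) + 0#                            ≈⟨ +-congˡ (-‿inverseʳ (natural b′)) ⟨
      (natural a - natural b) + (natural b′ - natural b′)     ≈⟨ interchange _ _ _ _ ⟩
      (natural a + natural b′) + (- natural b - natural b′)   ≈⟨ +-cong crossed (+-comm _ _) ⟩
      (natural a′ + natural b) + (- natural b′ - natural b)   ≈⟨ interchange _ _ _ _ ⟩
      (natural a′ - natural b′) + (natural b - natural b)     ≈⟨ +-congˡ (-‿inverseʳ (natural b)) ⟩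
      (natural a′ - natural b′) + 0#                          ≈⟨ +-identityʳ _ ⟩
      natural a′ - natural b′                                 ∎)
      where
      crossed : natural a + natural b′ ≈ natural a′ + natural b
      crossed = trans (sym (×-homo-+ 1# a b′)) (trans (reflexive (≡.cong natural eq)) (×-homo-+ 1# a′ b))

  open RingSolver differences (fromCommutativeRing commutativeRing) difference-homomorphism difference-≟ public
    using (solve; _:=_; _:+_; _:*_; _:-_; :-_; con)

-- Cancellation, finite sums and products.

module Sums {c ℓ} (L : Field c ℓ) where
  open Field L hiding (zero)
  open FieldProperties L
  open RingProperties ring
  open SemiringSum semiring using (sum-cong-≋; sum-remove; sum-replicate-zero; ∑-distrib-+)
  open SetoidReasoning setoid

  *-cancelˡ-≉0 : ∀ {a b c} → a ≉ 0# → a * b ≈ a * c → b ≈ c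
  *-cancelˡ-≉0 {a} {b} {c} a≉0 ab≈ac with invertible a a≉0
  ... | a⁻¹ , aa⁻¹≈1 = begin
    b               ≈⟨ unit b ⟨
    a⁻¹ * (a * b)   ≈⟨ *-congˡ ab≈ac ⟩
    a⁻¹ * (a * c)   ≈⟨ unit c ⟩
    c               ∎
    where
    unit : ∀ d → a⁻¹ * (a * d) ≈ d
    unit d = begin
      a⁻¹ * (a * d)   ≈⟨ solve 3 (λ a⁻¹ a d → a⁻¹ :* (a :* d) := (a :* a⁻¹) :* d) refl a⁻¹ a d ⟩
      (a * a⁻¹) * d   ≈⟨ *-congʳ aa⁻¹≈1 ⟩
      1# * d          ≈⟨ *-identityˡ d ⟩
      d               ∎

  *-≉0 : ∀ {a b} → a ≉ 0# → b ≉ 0# → a * b ≉ 0#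
  *-≉0 {a} a≉0 b≉0 ab≈0 = b≉0 (*-cancelˡ-≉0 a≉0 (trans ab≈0 (sym (zeroʳ a))))

  unit⇒≉0 : ∀ {a b} → a * b ≈ 1# → a ≉ 0#
  unit⇒≉0 {a} {b} ab≈1 a≈0 = 0≉1 (trans (sym (zeroˡ b)) (trans (*-congʳ (sym a≈0)) ab≈1))

  ≉⇒-≉0 : ∀ {a b} → a ≉ b → a - b ≉ 0#
  ≉⇒-≉0 a≉b = a≉b ∘ x∙y⁻¹≈ε⇒x≈y _ _

  product-≉0 : ∀ {n} (v : Vector Carrier n) → (∀ i → v i ≉ 0#) → product v ≉ 0#
  product-≉0 {zero}  v v≉0 = 0≉1 ∘ sym
  product-≉0 {suc n} v v≉0 = *-≉0 (v≉0 zero) (product-≉0 (tail v) (v≉0 ∘ suc))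

  product-≈0 : ∀ {n} (v : Vector Carrier n) i → v i ≈ 0# → product v ≈ 0#
  product-≈0 v zero    vi≈0 = trans (*-congʳ vi≈0) (zeroˡ _)
  product-≈0 v (suc i) vi≈0 = trans (*-congˡ (product-≈0 (tail v) i vi≈0)) (zeroʳ _)

  ^-≉0 : ∀ {a} n → a ≉ 0# → a ^ n ≉ 0#
  ^-≉0 zero    a≉0 = 0≉1 ∘ sym
  ^-≉0 (suc n) a≉0 = *-≉0 a≉0 (^-≉0 n a≉0)

  sum-≈0 : ∀ {n} (v : Vector Carrier n) → (∀ i → v i ≈ 0#) → sum v ≈ 0#
  sum-≈0 {n} v v≈0 = trans (sum-cong-≋ v≈0) (sum-replicate-zero n)

  sum-single : ∀ {n} (v : Vector Carrier n) i → (∀ j → j ≢ i → v j ≈ 0#) → sum v ≈ v i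
  sum-single {suc n} v i v≈0 = begin
    sum v                     ≈⟨ sum-remove v ⟩
    v i + sum (removeAt v i)  ≈⟨ +-congˡ (sum-≈0 _ λ j → v≈0 _ (punchInᵢ≢i i j)) ⟩
    v i + 0#                  ≈⟨ +-identityʳ _ ⟩
    v i                       ∎

  sum-pair : ∀ {n} (v : Vector Carrier n) {i j} → i ≢ j → (∀ k → k ≢ i → k ≢ j → v k ≈ 0#) → sum v ≈ v i + v j
  sum-pair {suc n} v {i} {j} i≢j v≈0 = begin
    sum v                                  ≈⟨ sum-remove v ⟩
    v i + sum (removeAt v i)               ≈⟨ +-congˡ (sum-single _ (punchOut i≢j) others) ⟩
    v i + v (punchIn i (punchOut i≢j))     ≡⟨ ≡.cong (λ k → v i + v k) (punchIn-punchOut i≢j) ⟩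
    v i + v j                              ∎
    where
    others : ∀ k → k ≢ punchOut i≢j → v (punchIn i k) ≈ 0#
    others k k≢ = v≈0 _ (punchInᵢ≢i i k) λ eq →
      k≢ (Fin.punchIn-injective i k _ (≡.trans eq (≡.sym (punchIn-punchOut i≢j))))

  sum-neg : ∀ {n} (v : Vector Carrier n) → sum (λ i → - v i) ≈ - sum v
  sum-neg {zero}  v = sym -0#≈0#
  sum-neg {suc n} v = trans (+-congˡ (sum-neg (tail v))) (-‿+-comm _ _)

  sum-- : ∀ {n} (v w : Vector Carrier n) → sum v - sum w ≈ sum (λ i → v i - w i)
  sum-- v w = trans (+-congˡ (sym (sum-neg w))) (sym (∑-distrib-+ v (λ i → - w i)))

-- Polynomials in one variable and their roots.

module Polynomials {c ℓ} (L : Field c ℓ) where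
  open Field L hiding (zero)
  open FieldProperties L
  open Sums L
  open RingProperties ring
  open SemiringSum semiring using (sum-cong-≋; *-distribˡ-sum)
  open SetoidReasoning setoid

  -- Horner's form: synthetic division and compatibility with homomorphisms then follow by recursion
  -- on the coefficient vector.
  eval : ∀ {n} → Vector Carrier n → Carrier → Carrier
  eval {zero}  p X = 0#
  eval {suc n} p X = head p + X * eval (tail p) X

  sum≈eval : ∀ {n} (p : Vector Carrier n) X → (sum λ j → p j * X ^ toℕ j) ≈ eval p X
  sum≈eval {zero}  p X = refl
  sum≈eval {suc n} p X = +-cong (*-identityʳ _) (begin
    (sum λ j → tail p j * (X * X ^ toℕ j))   ≈⟨ sum-cong-≋ (λ j → solve 3 (λ a b c → a :* (b :* c) := b :* (a :* c)) refl (tail p j) X (X ^ toℕ j)) ⟩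
    (sum λ j → X * (tail p j * X ^ toℕ j))   ≈⟨ *-distribˡ-sum X (λ j → tail p j * X ^ toℕ j) ⟨
    X * (sum λ j → tail p j * X ^ toℕ j)     ≈⟨ *-congˡ (sum≈eval (tail p) X) ⟩
    X * eval (tail p) X                      ∎)

  eval-cong : ∀ {n} {p q : Vector Carrier n} {X Y} → (∀ i → p i ≈ q i) → X ≈ Y → eval p X ≈ eval q Y
  eval-cong {zero}  p≈q X≈Y = refl
  eval-cong {suc n} p≈q X≈Y = +-cong (p≈q zero) (*-cong X≈Y (eval-cong (p≈q ∘ suc) X≈Y))

  eval-0 : ∀ {n} (p : Vector Carrier n) X → (∀ i → p i ≈ 0#) → eval p X ≈ 0#
  eval-0 {zero}  p X p≈0 = refl
  eval-0 {suc n} p X p≈0 = trans (+-cong (p≈0 zero) (trans (*-congˡ (eval-0 (tail p) X (p≈0 ∘ suc))) (zeroʳ X))) (+-identityˡ 0#)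

  eval-+ : ∀ {n} (p q : Vector Carrier n) X → eval (λ i → p i + q i) X ≈ eval p X + eval q X
  eval-+ {zero}  p q X = sym (+-identityˡ 0#)
  eval-+ {suc n} p q X = trans (+-congˡ (*-congˡ (eval-+ (tail p) (tail q) X)))
    (solve 5 (λ a b X c d → (a :+ b) :+ X :* (c :+ d) := (a :+ X :* c) :+ (b :+ X :* d)) refl
      (head p) (head q) X (eval (tail p) X) (eval (tail q) X))

  eval-scale : ∀ {n} a (p : Vector Carrier n) X → eval (λ i → a * p i) X ≈ a * eval p X
  eval-scale {zero}  a p X = sym (zeroʳ a)
  eval-scale {suc n} a p X = trans (+-congˡ (*-congˡ (eval-scale a (tail p) X)))
    (solve 4 (λ a b X c → a :* b :+ X :* (a :* c) := a :* (b :+ X :* c)) refl a (head p) X (eval (tail p) X))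

  eval-neg : ∀ {n} (p : Vector Carrier n) X → eval (λ i → - p i) X ≈ - eval p X
  eval-neg p X = begin
    eval (λ i → - p i) X        ≈⟨ eval-cong (λ i → sym (-1*x≈-x (p i))) refl ⟩
    eval (λ i → - 1# * p i) X   ≈⟨ eval-scale (- 1#) p X ⟩
    - 1# * eval p X             ≈⟨ -1*x≈-x _ ⟩
    - eval p X                  ∎

  eval-sum : ∀ {m n} (a : Vector Carrier m) (p : Fin m → Vector Carrier n) X →
    eval (λ i → sum λ l → a l * p l i) X ≈ sum λ l → a l * eval (p l) X
  eval-sum {zero} {n} a p X = eval-0 {n} (λ _ → 0#) X (λ _ → refl)
  eval-sum {suc m} a p X = trans (eval-+ (λ i → a zero * p zero i) _ X)
    (+-cong (eval-scale (a zero) (p zero) X) (eval-sum (tail a) (p ∘ suc) X))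

  -- Synthetic division of p by X - a.
  quotient : ∀ {n} → Vector Carrier (suc n) → Carrier → Vector Carrier n
  quotient {suc n} p a zero    = eval (tail p) a
  quotient {suc n} p a (suc i) = quotient (tail p) a i

  eval-quotient : ∀ {n} (p : Vector Carrier (suc n)) a X → eval p X ≈ eval p a + (X - a) * eval (quotient p a) X
  eval-quotient {zero}  p a X = begin
    head p + X * 0#                        ≈⟨ +-congˡ (trans (zeroʳ X) (sym (zeroʳ a))) ⟩
    head p + a * 0#                        ≈⟨ +-identityʳ _ ⟨
    head p + a * 0# + 0#                   ≈⟨ +-congˡ (zeroʳ (X - a)) ⟨
    head p + a * 0# + (X - a) * 0#         ∎
  eval-quotient {suc n} p a X = begin
    head p + X * eval (tail p) X   ≈⟨ +-congˡ (*-congˡ (eval-quotient (tail p) a X)) ⟩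
    head p + X * (t + (X - a) * q) ≈⟨ solve 5 (λ h X t a q → h :+ X :* (t :+ (X :- a) :* q) := (h :+ a :* t) :+ (X :- a) :* (t :+ X :* q)) refl (head p) X t a q ⟩
    (head p + a * t) + (X - a) * (t + X * q) ∎
    where
    t = eval (tail p) a
    q = eval (quotient (tail p) a) X

  -- Position i of the quotient is `p (suc i)` plus a times an expression in the later coefficients,
  -- so the coefficients vanish from the top down.
  quotient≈0 : ∀ {n} (p : Vector Carrier (suc n)) a → (∀ i → quotient p a i ≈ 0#) → ∀ i → p (suc i) ≈ 0#
  quotient≈0 {suc n} p a q≈0 (suc i) = quotient≈0 (tail p) a (q≈0 ∘ suc) i
  quotient≈0 {suc n} p a q≈0 zero = begin
    p (suc zero)                                     ≈⟨ +-identityʳ _ ⟨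
    p (suc zero) + 0#                                ≈⟨ +-congˡ (zeroʳ a) ⟨
    p (suc zero) + a * 0#                            ≈⟨ +-congˡ (*-congˡ (eval-0 _ a (quotient≈0 (tail p) a (q≈0 ∘ suc)))) ⟨
    p (suc zero) + a * eval (tail (tail p)) a        ≈⟨ q≈0 zero ⟩
    0#                                               ∎

  Distinct : ∀ {n} → Vector Carrier n → Set ℓ
  Distinct x = ∀ {i j} → i ≢ j → x i ≉ x j

  -- Dividing by X - x₀ leaves a polynomial with one coefficient fewer that vanishes at the
  -- remaining points. By induction it is zero, so only the constant coefficient of p is left, and
  -- that is the value at x₀.
  roots⇒≈0 : ∀ {n} (x : Vector Carrier n) → Distinct x → (p : Vector Carrier n) →
    (∀ i → eval p (x i) ≈ 0#) → ∀ i → p i ≈ 0#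
  roots⇒≈0 {suc n} x distinct p root = λ where
      (suc i) → higher i
      zero → begin
        p zero                                ≈⟨ +-identityʳ _ ⟨
        p zero + 0#                           ≈⟨ +-congˡ (zeroʳ a) ⟨
        p zero + a * 0#                       ≈⟨ +-congˡ (*-congˡ (eval-0 (tail p) a higher)) ⟨
        p zero + a * eval (tail p) a          ≈⟨ root zero ⟩
        0#                                    ∎
    where
    a = head x
    quotient-root : ∀ i → eval (quotient p a) (x (suc i)) ≈ 0#
    quotient-root i = *-cancelˡ-≉0 (≉⇒-≉0 (distinct {suc i} {zero} λ ())) (begin
      (x (suc i) - a) * eval (quotient p a) (x (suc i))             ≈⟨ +-identityˡ _ ⟨
      0# + (x (suc i) - a) * eval (quotient p a) (x (suc i))        ≈⟨ +-congʳ (root zero) ⟨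
      eval p a + (x (suc i) - a) * eval (quotient p a) (x (suc i))  ≈⟨ eval-quotient p a (x (suc i)) ⟨
      eval p (x (suc i))                                            ≈⟨ root (suc i) ⟩
      0#                                                            ≈⟨ zeroʳ _ ⟨
      (x (suc i) - a) * 0#                                          ∎)
    higher : ∀ i → p (suc i) ≈ 0#
    higher = quotient≈0 p a (roots⇒≈0 (tail x) (λ i≢j → distinct (i≢j ∘ suc-injective)) (quotient p a) quotient-root)

  eval-injective : ∀ {n} (x : Vector Carrier n) → Distinct x → (p q : Vector Carrier n) →
    (∀ i → eval p (x i) ≈ eval q (x i)) → ∀ i → p i ≈ q i
  eval-injective x distinct p q eq i = x∙y⁻¹≈ε⇒x≈y _ _ (roots⇒≈0 x distinct (λ i → p i - q i) (λ j → begin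
    eval (λ i → p i - q i) (x j)                    ≈⟨ eval-+ p (λ i → - q i) (x j) ⟩
    eval p (x j) + eval (λ i → - q i) (x j)         ≈⟨ +-cong (eq j) (eval-neg q (x j)) ⟩
    eval q (x j) - eval q (x j)                     ≈⟨ -‿inverseʳ _ ⟩
    0#                                              ∎) i)

-- Elementary symmetric functions through power series.

module ElementarySymmetric {c ℓ} (L : Field c ℓ) where
  open Field L hiding (zero)
  open FieldProperties L
  open Polynomials L
  open RingProperties ring
  open SetoidReasoning setoid

  Sequence : Set c
  Sequence = ℕ → Carrier

  -- A sequence E stands for the power series E₀ + E₁T + E₂T² + ⋯.  Multiplication
  -- and division by 1 + aT:
  multiply divide : Carrier → Sequence → Sequence
  multiply a E zero    = E zero
  multiply a E (suc j) = E (suc j) + a * E j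
  divide a E zero    = E zero
  divide a E (suc j) = E (suc j) - a * divide a E j

  multiply-cong : ∀ {a b E F} → a ≈ b → (∀ j → E j ≈ F j) → ∀ j → multiply a E j ≈ multiply b F j
  multiply-cong a≈b E≈F zero    = E≈F zero
  multiply-cong a≈b E≈F (suc j) = +-cong (E≈F (suc j)) (*-cong a≈b (E≈F j))

  divide-cong : ∀ {a E F} → (∀ j → E j ≈ F j) → ∀ j → divide a E j ≈ divide a F j
  divide-cong E≈F zero    = E≈F zero
  divide-cong E≈F (suc j) = +-cong (E≈F (suc j)) (-‿cong (*-congˡ (divide-cong E≈F j)))

  multiply-comm : ∀ a b E j → multiply a (multiply b E) j ≈ multiply b (multiply a E) j
  multiply-comm a b E zero          = refl
  multiply-comm a b E (suc zero)    =
    solve 4 (λ a b e₁ e₀ → (e₁ :+ b :* e₀) :+ a :* e₀ := (e₁ :+ a :* e₀) :+ b :* e₀) refl a b (E 1) (E 0)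
  multiply-comm a b E (suc (suc j)) =
    solve 5 (λ a b e₂ e₁ e₀ → (e₂ :+ b :* e₁) :+ a :* (e₁ :+ b :* e₀) := (e₂ :+ a :* e₁) :+ b :* (e₁ :+ a :* e₀)) refl
      a b (E (suc (suc j))) (E (suc j)) (E j)

  divide-multiply : ∀ a E j → divide a (multiply a E) j ≈ E j
  divide-multiply a E zero    = refl
  divide-multiply a E (suc j) = begin
    (E (suc j) + a * E j) - a * divide a (multiply a E) j   ≈⟨ +-congˡ (-‿cong (*-congˡ (divide-multiply a E j))) ⟩
    (E (suc j) + a * E j) - a * E j                         ≈⟨ solve 2 (λ e f → e :+ f :- f := e) refl (E (suc j)) (a * E j) ⟩
    E (suc j)                                               ∎

  -- Both operations are multiplication by a fixed power series, namely 1/(1 + aT) and 1 + bT.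
  divide-multiply-comm : ∀ a b E j → divide a (multiply b E) j ≈ multiply b (divide a E) j
  divide-multiply-comm a b E zero          = refl
  divide-multiply-comm a b E (suc zero)    =
    solve 4 (λ a b e₁ e₀ → (e₁ :+ b :* e₀) :- a :* e₀ := (e₁ :- a :* e₀) :+ b :* e₀) refl a b (E 1) (E 0)
  divide-multiply-comm a b E (suc (suc j)) = begin
    (E (suc (suc j)) + b * E (suc j)) - a * divide a (multiply b E) (suc j)
      ≈⟨ +-congˡ (-‿cong (*-congˡ (divide-multiply-comm a b E (suc j)))) ⟩
    (E (suc (suc j)) + b * E (suc j)) - a * (D (suc j) + b * D j)
      ≈⟨ solve 6 (λ a b e₂ e₁ d₁ d₀ → (e₂ :+ b :* e₁) :- a :* (d₁ :+ b :* d₀) := (e₂ :- a :* d₁) :+ b :* (e₁ :- a :* d₀)) refl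
           a b (E (suc (suc j))) (E (suc j)) (D (suc j)) (D j) ⟩
    (E (suc (suc j)) - a * D (suc j)) + b * (E (suc j) - a * D j) ∎
    where
    D = divide a E

  -- The coefficients of ∏ (1 + vᵢT). In this form, omitting one entry is division by 1 + vᵢT, which
  -- involves only that entry and the symmetric functions of all.
  esym : ∀ {n} → Vector Carrier n → Sequence
  esym {zero}  v zero    = 1#
  esym {zero}  v (suc j) = 0#
  esym {suc n} v         = multiply (head v) (esym (tail v))

  private
    value : List (List Carrier) → Carrier
    value l = foldr _+_ 0# (map (foldr _*_ 1#) l)

    value-++ : ∀ l l′ → value (l ++ l′) ≈ value l + value l′
    value-++ []      l′ = sym (+-identityˡ _)
    value-++ (m ∷ l) l′ = trans (+-congˡ (value-++ l l′)) (sym (+-assoc _ _ _))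

    value-∷ : ∀ a l → value (map (a ∷_) l) ≈ a * value l
    value-∷ a []      = sym (zeroʳ a)
    value-∷ a (m ∷ l) = trans (+-congˡ (value-∷ a l)) (sym (distribˡ a _ _))

  esym-zero : ∀ {n} (v : Vector Carrier n) → esym v 0 ≈ 1#
  esym-zero {zero}  v = refl
  esym-zero {suc n} v = esym-zero (tail v)

  elementary≈esym : ∀ {n} (v : Vector Carrier n) j → elementary L j v ≈ esym v j
  elementary≈esym v       zero    = trans (+-identityʳ 1#) (sym (esym-zero v))
  elementary≈esym {zero}  v (suc j) = refl
  elementary≈esym {suc n} v (suc j) = begin
    value (map (head v ∷_) C ++ C′)               ≈⟨ value-++ (map (head v ∷_) C) C′ ⟩
    value (map (head v ∷_) C) + value C′          ≈⟨ +-comm _ _ ⟩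
    value C′ + value (map (head v ∷_) C)          ≈⟨ +-congˡ (value-∷ (head v) C) ⟩
    value C′ + head v * value C                   ≈⟨ +-cong (elementary≈esym (tail v) (suc j)) (*-congˡ (elementary≈esym (tail v) j)) ⟩
    esym (tail v) (suc j) + head v * esym (tail v) j ∎
    where
    C  = combinations j (tabulate (tail v))
    C′ = combinations (suc j) (tabulate (tail v))

  esym-cong : ∀ {n} {v w : Vector Carrier n} → (∀ i → v i ≈ w i) → ∀ j → esym v j ≈ esym w j
  esym-cong {zero}  v≈w zero    = refl
  esym-cong {zero}  v≈w (suc j) = refl
  esym-cong {suc n} v≈w         = multiply-cong (v≈w zero) (esym-cong (v≈w ∘ suc))

  esym-remove : ∀ {n} (v : Vector Carrier (suc n)) i j → esym v j ≈ multiply (v i) (esym (removeAt v i)) j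
  esym-remove v zero j = refl
  esym-remove {suc n} v (suc i) j =
    trans (multiply-cong refl (esym-remove (tail v) i) j) (multiply-comm (head v) (v (suc i)) (esym (removeAt (tail v) i)) j)

  -- The factor belonging to `π ⟨$⟩ʳ zero` is moved to the front; the remaining entries are permuted
  -- by `Perm.remove zero π`.
  esym-permute : ∀ {n} (v : Vector Carrier n) (π : Permutation′ n) j → esym (v ∘ (π ⟨$⟩ʳ_)) j ≈ esym v j
  esym-permute {zero}  v π zero    = refl
  esym-permute {zero}  v π (suc j) = refl
  esym-permute {suc n} v π j = begin
    multiply (v (π ⟨$⟩ʳ zero)) (esym (v ∘ (π ⟨$⟩ʳ_) ∘ suc)) j
      ≈⟨ multiply-cong refl (λ j → trans (esym-cong (λ i → reflexive (≡.cong v (Perm.punchIn-permute π zero i))) j)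
                                         (esym-permute (removeAt v (π ⟨$⟩ʳ zero)) (Perm.remove zero π) j)) j ⟩
    multiply (v (π ⟨$⟩ʳ zero)) (esym (removeAt v (π ⟨$⟩ʳ zero))) j
      ≈⟨ esym-remove v (π ⟨$⟩ʳ zero) j ⟨
    esym v j ∎

  esym-high : ∀ {n} (v : Vector Carrier n) {j} → n < j → esym v j ≈ 0#
  esym-high {zero}  v {suc j} n<j       = refl
  esym-high {suc n} v {suc j} (s≤s n<j) = begin
    esym (tail v) (suc j) + head v * esym (tail v) j  ≈⟨ +-cong (esym-high (tail v) (ℕ.m<n⇒m<1+n n<j)) (*-congˡ (esym-high (tail v) n<j)) ⟩
    0# + head v * 0#                                  ≈⟨ trans (+-identityˡ _) (zeroʳ _) ⟩
    0#                                                ∎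

  divide-esym : ∀ {n} (v : Vector Carrier (suc n)) i j → divide (v i) (esym v) j ≈ esym (removeAt v i) j
  divide-esym v i j = trans (divide-cong (esym-remove v i) j) (divide-multiply (v i) _ j)

  -- `divide X E n` is the sum of the E (n - j) (-X)ʲ, which for the elementary symmetric functions
  -- of n entries is the expansion of ∏ (vᵢ - X). In the induction the top coefficient of the tail
  -- vanishes, its degree exceeding the number of entries.
  divide-esym-product : ∀ {n} (v : Vector Carrier n) X → divide X (esym v) n ≈ product λ i → v i - X
  divide-esym-product {zero}  v X = refl
  divide-esym-product {suc n} v X = begin
    divide X (multiply (head v) E) (suc n)                        ≈⟨ divide-multiply-comm X (head v) E (suc n) ⟩
    (E (suc n) - X * D n) + head v * D n                          ≈⟨ +-congʳ (+-congʳ (esym-high (tail v) (ℕ.n<1+n n))) ⟩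
    (0# - X * D n) + head v * D n                                 ≈⟨ trans (+-congʳ (+-identityˡ _)) (solve 3 (λ X d h → :- (X :* d) :+ h :* d := (h :- X) :* d) refl X (D n) (head v)) ⟩
    (head v - X) * D n                                            ≈⟨ *-congˡ (divide-esym-product (tail v) X) ⟩
    (head v - X) * (product λ i → tail v i - X)                   ∎
    where
    E = esym (tail v)
    D = divide X E

  -- The coefficients of Eₘ - Eₘ₋₁X + Eₘ₋₂X² - ⋯ ± E₀Xᵐ.
  alternating : Sequence → ∀ m → Vector Carrier (suc m)
  alternating E m       zero    = E m
  alternating E (suc m) (suc i) = - alternating E m i

  eval-alternating : ∀ E m X → eval (alternating E m) X ≈ divide X E m
  eval-alternating E zero    X = trans (+-congˡ (zeroʳ X)) (+-identityʳ _)
  eval-alternating E (suc m) X = +-congˡ (begin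
    X * eval (λ i → - alternating E m i) X  ≈⟨ *-congˡ (eval-neg (alternating E m) X) ⟩
    X * - eval (alternating E m) X          ≈⟨ -‿distribʳ-* X _ ⟨
    - (X * eval (alternating E m) X)        ≈⟨ -‿cong (*-congˡ (eval-alternating E m X)) ⟩
    - (X * divide X E m)                    ∎)

-- Lagrange interpolation.

module Interpolation {c ℓ} (L : Field c ℓ) where
  open Field L hiding (zero)
  open FieldProperties L
  open Sums L
  open Polynomials L
  open ElementarySymmetric L
  open SetoidReasoning setoid

  -- The coefficients of ∏ (x b - X) over all b ≢ l.
  basis : ∀ {n} → Vector Carrier (suc n) → Fin (suc n) → Vector Carrier (suc n)
  basis {n} x l = alternating (divide (x l) (esym x)) n

  δ : ∀ {n} → Vector Carrier (suc n) → Vector Carrier (suc n)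
  δ x l = product λ b → removeAt x l b - x l

  eval-basis : ∀ {n} (x : Vector Carrier (suc n)) l X → eval (basis x l) X ≈ product λ b → removeAt x l b - X
  eval-basis {n} x l X = begin
    eval (basis x l) X                      ≈⟨ eval-alternating (divide (x l) (esym x)) n X ⟩
    divide X (divide (x l) (esym x)) n      ≈⟨ divide-cong (divide-esym x l) n ⟩
    divide X (esym (removeAt x l)) n        ≈⟨ divide-esym-product (removeAt x l) X ⟩
    (product λ b → removeAt x l b - X)      ∎

  -- The product defining `δ x l` mentions all the points; the right-hand side mentions only `x l`
  -- and symmetric functions. This exhibits `δ x l` as a polynomial in `x l` with symmetric
  -- coefficients.
  δ≈divide : ∀ {n} (x : Vector Carrier (suc n)) l → δ x l ≈ divide (x l) (divide (x l) (esym x)) n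
  δ≈divide {n} x l = trans (sym (eval-basis x l (x l))) (eval-alternating (divide (x l) (esym x)) n (x l))

  removeAt-punchOut : ∀ {n} (x : Vector Carrier (suc n)) {l m} (l≢m : l ≢ m) → removeAt x l (punchOut l≢m) ≈ x m
  removeAt-punchOut x l≢m = reflexive (≡.cong x (punchIn-punchOut l≢m))

  eval-basis-other : ∀ {n} (x : Vector Carrier (suc n)) {l m} → l ≢ m → eval (basis x l) (x m) ≈ 0#
  eval-basis-other x {l} {m} l≢m = trans (eval-basis x l (x m))
    (product-≈0 _ (punchOut l≢m) (trans (+-congʳ (removeAt-punchOut x l≢m)) (-‿inverseʳ (x m))))

  module _ {n} (x : Vector Carrier (suc n)) (distinct : Distinct x) where

    δ≉0 : ∀ l → δ x l ≉ 0#
    δ≉0 l = product-≉0 _ λ b → ≉⇒-≉0 (distinct (punchInᵢ≢i l b))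

    δ⁻¹ : Vector Carrier (suc n)
    δ⁻¹ l = proj₁ (invertible (δ x l) (δ≉0 l))

    -- `weight i l` is the Cₗ of the overview: the coefficient of Xⁱ in the l-th Lagrange
    -- polynomial.
    weight : Fin (suc n) → Vector Carrier (suc n)
    weight i l = δ⁻¹ l * basis x l i

    weight-δ : ∀ i l → weight i l * δ x l ≈ basis x l i
    weight-δ i l = begin
      (δ⁻¹ l * basis x l i) * δ x l   ≈⟨ solve 3 (λ d b e → (d :* b) :* e := (e :* d) :* b) refl (δ⁻¹ l) (basis x l i) (δ x l) ⟩
      (δ x l * δ⁻¹ l) * basis x l i   ≈⟨ *-congʳ (proj₂ (invertible (δ x l) (δ≉0 l))) ⟩
      1# * basis x l i                ≈⟨ *-identityˡ _ ⟩
      basis x l i                     ∎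

    interpolation : ∀ {u v : Vector Carrier (suc n)} → (∀ l → eval u (x l) ≈ v l) →
      ∀ i → u i ≈ sum λ l → v l * weight i l
    interpolation {u} {v} u-interpolates i = trans
      (eval-injective x distinct u (λ i → sum λ l → (v l * δ⁻¹ l) * basis x l i) agree i)
      (SemiringSum.sum-cong-≋ semiring λ l → *-assoc (v l) (δ⁻¹ l) (basis x l i))
      where
      agree : ∀ m → eval u (x m) ≈ eval (λ i → sum λ l → (v l * δ⁻¹ l) * basis x l i) (x m)
      agree m = sym (begin
        eval (λ i → sum λ l → (v l * δ⁻¹ l) * basis x l i) (x m)
          ≈⟨ eval-sum (λ l → v l * δ⁻¹ l) (basis x) (x m) ⟩
        (sum λ l → (v l * δ⁻¹ l) * eval (basis x l) (x m))
          ≈⟨ sum-single (λ l → (v l * δ⁻¹ l) * eval (basis x l) (x m)) m (λ l l≢m → trans (*-congˡ (eval-basis-other x l≢m)) (zeroʳ _)) ⟩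
        (v m * δ⁻¹ m) * eval (basis x m) (x m)
          ≈⟨ *-congˡ (eval-basis x m (x m)) ⟩
        (v m * δ⁻¹ m) * δ x m
          ≈⟨ solve 3 (λ v d e → (v :* d) :* e := v :* (e :* d)) refl (v m) (δ⁻¹ m) (δ x m) ⟩
        v m * (δ x m * δ⁻¹ m)
          ≈⟨ *-congˡ (proj₂ (invertible (δ x m) (δ≉0 m))) ⟩
        v m * 1#
          ≈⟨ *-identityʳ _ ⟩
        v m
          ≈⟨ u-interpolates m ⟨
        eval u (x m) ∎)

-- Generated subfields and symmetric sums of polynomial values.

module Subfield {c ℓ p} (L : Field c ℓ) (S : Pred (Field.Carrier L) p) where
  open Field L hiding (zero)
  open FieldProperties L
  open Sums L
  open Polynomials L
  open ElementarySymmetric L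
  open Interpolation L
  open RingProperties ring
  open SemiringSum semiring using (sum-cong-≋; ∑-distrib-+; *-distribˡ-sum)
  open SetoidReasoning setoid

  F : Pred Carrier (c ⊔ ℓ ⊔ p)
  F = Generated L S

  minus-closed : ∀ {a b} → a ∈ F → b ∈ F → a - b ∈ F
  minus-closed a∈F b∈F = add-closed a∈F (neg-closed b∈F)

  product-closed : ∀ {n} {v : Vector Carrier n} → (∀ i → v i ∈ F) → product v ∈ F
  product-closed {zero}  v∈F = one-closed
  product-closed {suc n} v∈F = mul-closed (v∈F zero) (product-closed (v∈F ∘ suc))

  sum-closed : ∀ {n} {v : Vector Carrier n} → (∀ i → v i ∈ F) → sum v ∈ F
  sum-closed {zero}  v∈F = zero-closed
  sum-closed {suc n} v∈F = add-closed (v∈F zero) (sum-closed (v∈F ∘ suc))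

  natural-closed : ∀ m → natural m ∈ F
  natural-closed zero    = zero-closed
  natural-closed (suc m) = add-closed one-closed (natural-closed m)

  cancel-closed : ∀ {a b} → b ≉ 0# → b ∈ F → a * b ∈ F → a ∈ F
  cancel-closed {a} {b} b≉0 b∈F ab∈F with invertible b b≉0
  ... | b⁻¹ , bb⁻¹≈1 = ≈-closed (begin
    (a * b) * b⁻¹   ≈⟨ *-assoc a b b⁻¹ ⟩
    a * (b * b⁻¹)   ≈⟨ *-congˡ bb⁻¹≈1 ⟩
    a * 1#          ≈⟨ *-identityʳ a ⟩
    a               ∎) (mul-closed ab∈F (inv-closed b∈F bb⁻¹≈1))

  -- The families (φ(v₀), …, φ(vₙ₋₁)) with φ a polynomial over F.
  data PolynomialIn {n} (v : Vector Carrier n) : Vector Carrier n → Set (c ⊔ ℓ ⊔ p) where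
    constant : ∀ {a} → a ∈ F → PolynomialIn v (λ _ → a)
    coordinate : PolynomialIn v v
    plus     : ∀ {φ ψ} → PolynomialIn v φ → PolynomialIn v ψ → PolynomialIn v (λ i → φ i + ψ i)
    mult     : ∀ {φ ψ} → PolynomialIn v φ → PolynomialIn v ψ → PolynomialIn v (λ i → φ i * ψ i)
    respects : ∀ {φ ψ} → (∀ i → φ i ≈ ψ i) → PolynomialIn v φ → PolynomialIn v ψ

  module _ {n} {v : Vector Carrier n} where

    neg : ∀ {φ} → PolynomialIn v φ → PolynomialIn v (λ i → - φ i)
    neg φ∈ = respects (λ i → -1*x≈-x _) (mult (constant (neg-closed one-closed)) φ∈)

    prod : ∀ {m} {φ : Fin m → Vector Carrier n} → (∀ b → PolynomialIn v (φ b)) → PolynomialIn v (λ i → product λ b → φ b i)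
    prod {zero}  φ∈ = constant one-closed
    prod {suc m} φ∈ = mult (φ∈ zero) (prod (φ∈ ∘ suc))

    divide-polynomial : ∀ {E : Fin n → Sequence} → (∀ j → PolynomialIn v (λ i → E i j)) →
      ∀ j → PolynomialIn v (λ i → divide (v i) (E i) j)
    divide-polynomial E∈ zero    = E∈ zero
    divide-polynomial E∈ (suc j) = plus (E∈ (suc j)) (neg (mult coordinate (divide-polynomial E∈ j)))

    alternating-polynomial : ∀ {E : Fin n → Sequence} → (∀ j → PolynomialIn v (λ i → E i j)) →
      ∀ m k → PolynomialIn v (λ i → alternating (E i) m k)
    alternating-polynomial E∈ m       zero    = E∈ m
    alternating-polynomial E∈ (suc m) (suc k) = neg (alternating-polynomial E∈ m k)

  -- Σᵢ eⱼ(v without vᵢ) = (n - j) eⱼ(v), without the subtraction.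
  sum-divide-esym : ∀ {n} (v : Vector Carrier n) j →
    (sum λ i → divide (v i) (esym v) j) + natural j * esym v j ≈ natural n * esym v j
  sum-divide-esym {zero} v zero    = +-identityˡ _
  sum-divide-esym {zero} v (suc j) = trans (+-identityˡ _) (trans (zeroʳ _) (sym (zeroʳ _)))
  sum-divide-esym {suc n} v j = trans (+-congʳ (+-cong (divide-multiply a E j) (step j))) (total j)
    where
    a = head v
    E = esym (tail v)
    T : Sequence
    T j = sum λ i → divide (tail v i) E j
    IH : ∀ j → T j + natural j * E j ≈ natural n * E j
    IH = sum-divide-esym (tail v)
    step : ∀ j → (sum λ i → divide (tail v i) (multiply a E) j) ≈ multiply a T j
    step j = trans (sum-cong-≋ (λ i → divide-multiply-comm (tail v i) a E j)) (pull j)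
      where
      pull : ∀ j → (sum λ i → multiply a (divide (tail v i) E) j) ≈ multiply a T j
      pull zero    = refl
      pull (suc j) = trans (∑-distrib-+ (λ i → divide (tail v i) E (suc j)) (λ i → a * divide (tail v i) E j))
                           (+-congˡ (sym (*-distribˡ-sum a (λ i → divide (tail v i) E j))))
    total : ∀ j → (E j + multiply a T j) + natural j * multiply a E j ≈ natural (suc n) * multiply a E j
    total zero = begin
      (E 0 + T 0) + 0# * E 0          ≈⟨ +-assoc _ _ _ ⟩
      E 0 + (T 0 + 0# * E 0)          ≈⟨ +-cong (sym (*-identityˡ (E 0))) (IH 0) ⟩
      1# * E 0 + natural n * E 0      ≈⟨ distribʳ (E 0) 1# (natural n) ⟨
      (1# + natural n) * E 0          ∎
    -- `natural (suc j)` stays whole in front of `E (suc j)`, as the hypothesis at `suc j` requires.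
    -- In front of `a * E j` it is split, since the hypothesis at j absorbs only `natural j` copies;
    -- the copy left over completes the coefficient `multiply a E (suc j)`.
    total (suc j) = begin
      (E (suc j) + (T (suc j) + a * T j)) + (1# + natural j) * (E (suc j) + a * E j)
        ≈⟨ +-congˡ (*-congˡ refl) ⟩
      (E (suc j) + (T (suc j) + a * T j)) + natural (suc j) * (E (suc j) + a * E j)
        ≈⟨ +-congˡ (distribˡ _ _ _) ⟩
      (E (suc j) + (T (suc j) + a * T j)) + (natural (suc j) * E (suc j) + (1# + natural j) * (a * E j))
        ≈⟨ +-congˡ (+-congˡ (trans (distribʳ (a * E j) 1# (natural j)) (+-congʳ (*-identityˡ _)))) ⟩
      (E (suc j) + (T (suc j) + a * T j)) + (natural (suc j) * E (suc j) + (a * E j + natural j * (a * E j)))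
        ≈⟨ solve 7 (λ e₁ t₁ a t₀ s₁ e₀ k → (e₁ :+ (t₁ :+ a :* t₀)) :+ (s₁ :* e₁ :+ (a :* e₀ :+ k :* (a :* e₀)))
                                      := (e₁ :+ a :* e₀) :+ ((t₁ :+ s₁ :* e₁) :+ a :* (t₀ :+ k :* e₀))) refl
             (E (suc j)) (T (suc j)) a (T j) (natural (suc j)) (E j) (natural j) ⟩
      (E (suc j) + a * E j) + ((T (suc j) + natural (suc j) * E (suc j)) + a * (T j + natural j * E j))
        ≈⟨ +-congˡ (+-cong (IH (suc j)) (*-congˡ (IH j))) ⟩
      (E (suc j) + a * E j) + (natural n * E (suc j) + a * (natural n * E j))
        ≈⟨ solve 4 (λ e₁ a e₀ k → (e₁ :+ a :* e₀) :+ (k :* e₁ :+ a :* (k :* e₀)) := (e₁ :+ a :* e₀) :+ k :* (e₁ :+ a :* e₀)) refl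
             (E (suc j)) a (E j) (natural n) ⟩
      (E (suc j) + a * E j) + natural n * (E (suc j) + a * E j)
        ≈⟨ +-congʳ (*-identityˡ _) ⟨
      1# * (E (suc j) + a * E j) + natural n * (E (suc j) + a * E j)
        ≈⟨ distribʳ _ 1# (natural n) ⟨
      natural (suc n) * (E (suc j) + a * E j) ∎

  module _ {n} (v : Vector Carrier n) (esym∈F : ∀ j → esym v j ∈ F) where

    private
      D : Fin n → Sequence
      D i = divide (v i) (esym v)

      -- Σᵢ eⱼ(v without vᵢ) vᵢᵐ, which unlike the power sums (j = 0) alone allows an
      -- induction on m without dividing by integers.
      mixed : ∀ m j → (sum λ i → D i j * v i ^ m) ∈ F

      power-sum : ∀ m → (sum λ i → v i ^ m) ∈ F
      power-sum m = ≈-closed (sum-cong-≋ {n} λ i → trans (*-congʳ (esym-zero v)) (*-identityˡ _)) (mixed m 0)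

      mixed zero j = ≈-closed
        (begin
          natural n * esym v j - natural j * esym v j                 ≈⟨ +-congʳ (sum-divide-esym v j) ⟨
          (sum (λ i → D i j) + natural j * esym v j) - natural j * esym v j
            ≈⟨ solve 2 (λ s t → (s :+ t) :- t := s) refl (sum (λ i → D i j)) (natural j * esym v j) ⟩
          (sum λ i → D i j)                                           ≈⟨ sum-cong-≋ {n} (λ i → *-identityʳ _) ⟨
          (sum λ i → D i j * 1#)                                      ∎)
        (minus-closed (mul-closed (natural-closed n) (esym∈F j)) (mul-closed (natural-closed j) (esym∈F j)))
      -- By definition `D i (suc j)` is `e - v i * D i j`, so one factor `v i` next to `D i j` can
      -- be traded for `e - D i (suc j)`. This lowers m and raises j.
      mixed (suc m) j = ≈-closed
        (begin
          e * (sum λ i → v i ^ m) - (sum λ i → D i (suc j) * v i ^ m)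
            ≈⟨ +-congʳ (*-distribˡ-sum e (λ i → v i ^ m)) ⟩
          (sum λ i → e * v i ^ m) - (sum λ i → D i (suc j) * v i ^ m)
            ≈⟨ sum-- (λ i → e * v i ^ m) (λ i → D i (suc j) * v i ^ m) ⟩
          (sum λ i → e * v i ^ m - (e - v i * D i j) * v i ^ m)
            ≈⟨ sum-cong-≋ {n} (λ i → solve 4 (λ e p x d → e :* p :- (e :- x :* d) :* p := d :* (x :* p)) refl e (v i ^ m) (v i) (D i j)) ⟩
          (sum λ i → D i j * v i ^ suc m) ∎)
        (minus-closed (mul-closed (esym∈F (suc j)) (power-sum m)) (mixed m (suc j)))
        where
        e = esym v (suc j)

      -- Knowing the sums of φ and of ψ says nothing about the sum of their product. Hence the
      -- induction over `PolynomialIn` treats φ as a multiplier on families all of whose moments lie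
      -- in F; having all m available lets `coordinate` act by a shift.
      Moments : Pred (Vector Carrier n) (c ⊔ ℓ ⊔ p)
      Moments ψ = ∀ m → (sum λ i → ψ i * v i ^ m) ∈ F

      multiplier : ∀ {φ} → PolynomialIn v φ → ∀ {ψ} → ψ ∈ Moments → (λ i → φ i * ψ i) ∈ Moments
      multiplier (constant {a} a∈F) {ψ} ψ∈ m = ≈-closed
        (trans (*-distribˡ-sum a (λ i → ψ i * v i ^ m)) (sum-cong-≋ {n} λ i → sym (*-assoc _ _ _)))
        (mul-closed a∈F (ψ∈ m))
      multiplier coordinate {ψ} ψ∈ m = ≈-closed
        (sum-cong-≋ {n} λ i → solve 3 (λ y x p → y :* (x :* p) := (x :* y) :* p) refl (ψ i) (v i) (v i ^ m))
        (ψ∈ (suc m))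
      multiplier (plus {φ₁} {φ₂} p q) {ψ} ψ∈ m = ≈-closed
        (trans (sym (∑-distrib-+ (λ i → φ₁ i * ψ i * v i ^ m) (λ i → φ₂ i * ψ i * v i ^ m)))
               (sum-cong-≋ {n} λ i → solve 4 (λ a b y p → a :* y :* p :+ b :* y :* p := (a :+ b) :* y :* p) refl (φ₁ i) (φ₂ i) (ψ i) (v i ^ m)))
        (add-closed (multiplier p ψ∈ m) (multiplier q ψ∈ m))
      multiplier (mult {φ₁} {φ₂} p q) {ψ} ψ∈ m = ≈-closed
        (sum-cong-≋ {n} λ i → *-congʳ (sym (*-assoc (φ₁ i) (φ₂ i) (ψ i))))
        (multiplier p (multiplier q ψ∈) m)
      multiplier (respects φ≈φ′ p) ψ∈ m = ≈-closed (sum-cong-≋ {n} λ i → *-congʳ (*-congʳ (φ≈φ′ i))) (multiplier p ψ∈ m)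

    -- φ is applied as a multiplier to the constant family 1, whose moments are the power sums. The
    -- moment m = 0 of the result is the sum of φ.
    sum-polynomial-closed : ∀ {φ} → PolynomialIn v φ → sum φ ∈ F
    sum-polynomial-closed φ∈ = ≈-closed
      (sum-cong-≋ {n} λ i → trans (*-identityʳ _) (*-identityʳ _))
      (multiplier φ∈ {λ _ → 1#} (λ m → ≈-closed (sum-cong-≋ {n} λ i → sym (*-identityˡ _)) (power-sum m)) 0)

  module _ {n} (v : Vector Carrier (suc n)) (esym∈F : ∀ j → esym v j ∈ F) where

    basis-polynomial : ∀ k → PolynomialIn v (λ i → basis v i k)
    basis-polynomial k = alternating-polynomial (divide-polynomial (λ j → constant (esym∈F j))) n k

    δ-polynomial : PolynomialIn v (δ v)
    δ-polynomial = respects (λ i → sym (δ≈divide v i)) (divide-polynomial (divide-polynomial (λ j → constant (esym∈F j))) n)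

    -- Q l is a polynomial over F in v l which vanishes for l ≢ k, so that Q k
    -- and v k * Q k are sums over all indices of polynomials over F.
    separated : ∀ {N M} → PolynomialIn v N → PolynomialIn v M → (κ : Vector Carrier (suc n)) → (∀ l → κ l ∈ F) →
      (∀ l → N l ≈ κ l * M l) → (∀ l → M l ≉ 0#) → Distinct κ → ∀ k → v k ∈ F
    separated {N} {M} N∈ M∈ κ κ∈F N≈κM M≉0 distinct k = cancel-closed Qk≉0 Qk∈F vkQk∈F
      where
      Q : Vector Carrier (suc n)
      -- Each factor is (κ l - κ b) M l with the denominator of κ = N / M cleared: κ itself need not
      -- be a polynomial in `v l`, while N and M are.
      Q l = product λ b → N l - removeAt κ k b * M l

      Q∈ : PolynomialIn v Q
      Q∈ = prod {m = n} λ b → plus N∈ (neg (mult (constant (κ∈F _)) M∈))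

      Q≈0 : ∀ l → l ≢ k → Q l ≈ 0#
      Q≈0 l l≢k = product-≈0 _ (punchOut (l≢k ∘ ≡.sym)) (begin
        N l - removeAt κ k (punchOut (l≢k ∘ ≡.sym)) * M l  ≈⟨ +-congˡ (-‿cong (*-congʳ (removeAt-punchOut κ (l≢k ∘ ≡.sym)))) ⟩
        N l - κ l * M l                                    ≈⟨ +-congˡ (-‿cong (N≈κM l)) ⟨
        N l - N l                                          ≈⟨ -‿inverseʳ (N l) ⟩
        0#                                                 ∎)

      Qk≉0 : Q k ≉ 0#
      Qk≉0 = product-≉0 _ λ b factor≈0 → *-≉0 (≉⇒-≉0 (distinct (punchInᵢ≢i k b ∘ ≡.sym))) (M≉0 k) (begin
        (κ k - removeAt κ k b) * M k       ≈⟨ solve 3 (λ a b m → (a :- b) :* m := a :* m :- b :* m) refl (κ k) (removeAt κ k b) (M k) ⟩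
        κ k * M k - removeAt κ k b * M k   ≈⟨ +-congʳ (N≈κM k) ⟨
        N k - removeAt κ k b * M k         ≈⟨ factor≈0 ⟩
        0#                                 ∎)

      Qk∈F : Q k ∈ F
      Qk∈F = ≈-closed (sum-single Q k Q≈0) (sum-polynomial-closed v esym∈F Q∈)

      vkQk∈F : v k * Q k ∈ F
      vkQk∈F = ≈-closed (sum-single (λ l → v l * Q l) k λ l l≢k → trans (*-congˡ (Q≈0 l l≢k)) (zeroʳ _))
        (sum-polynomial-closed v esym∈F (mult coordinate Q∈))

-- Field endomorphisms and the elements they fix.

module Endomorphisms {c ℓ} (L : Field c ℓ) where
  open Field L hiding (zero)
  open Sums L
  open SetoidReasoning setoid

  IsEndomorphism : (Carrier → Carrier) → Set (c ⊔ ℓ)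
  IsEndomorphism = IsRingHomomorphism rawRing rawRing

  module _ {σ : Carrier → Carrier} (σ-endo : IsEndomorphism σ) where
    open IsRingHomomorphism σ-endo

    fixes-generated : ∀ {p} {S : Pred Carrier p} → (∀ {a} → a ∈ S → σ a ≈ a) → ∀ {a} → a ∈ Generated L S → σ a ≈ a
    fixes-generated fixed (generator a∈S)         = fixed a∈S
    fixes-generated fixed (≈-closed a≈b a∈)       = trans (⟦⟧-cong (sym a≈b)) (trans (fixes-generated fixed a∈) a≈b)
    fixes-generated fixed zero-closed             = 0#-homo
    fixes-generated fixed one-closed              = 1#-homo
    fixes-generated fixed (add-closed a∈ b∈)      = trans (+-homo _ _) (+-cong (fixes-generated fixed a∈) (fixes-generated fixed b∈))
    fixes-generated fixed (mul-closed a∈ b∈)      = trans (*-homo _ _) (*-cong (fixes-generated fixed a∈) (fixes-generated fixed b∈))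
    fixes-generated fixed (neg-closed a∈)         = trans (-‿homo _) (-‿cong (fixes-generated fixed a∈))
    fixes-generated fixed (inv-closed {a} {b} a∈ ab≈1) = *-cancelˡ-≉0 (unit⇒≉0 ab≈1) (begin
      a * σ b     ≈⟨ *-congʳ (fixes-generated fixed a∈) ⟨
      σ a * σ b   ≈⟨ *-homo a b ⟨
      σ (a * b)   ≈⟨ ⟦⟧-cong ab≈1 ⟩
      σ 1#        ≈⟨ 1#-homo ⟩
      1#          ≈⟨ ab≈1 ⟨
      a * b       ∎)

-- Polynomial expressions in several variables and genericity.

module Expressions {c ℓ c′ ℓ′} (k : Field c ℓ) (L : Field c′ ℓ′) (ι : Field.Carrier k → Field.Carrier L)
                   (ι-homomorphism : IsRingHomomorphism (Field.rawRing k) (Field.rawRing L) ι) where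
  private
    module k = Field k
    module ι = IsRingHomomorphism ι-homomorphism
  open Field L hiding (zero)
  open FieldProperties L
  open RingProperties ring
  open SetoidReasoning setoid

  infixl 6 _⊕_
  infixl 7 _⊗_
  infix  8 ⊖_

  -- Syntax trees make the arithmetic of fractions immediate. The unique exponent vectors demanded
  -- by `AlgebraicallyIndependent` are produced only at the end, by `collect`.
  data Expr (n : ℕ) : Set c where
    var   : Fin n → Expr n
    const : k.Carrier → Expr n
    _⊕_   : Expr n → Expr n → Expr n
    _⊗_   : Expr n → Expr n → Expr n
    ⊖_    : Expr n → Expr n

  ⟦_⟧ : ∀ {n} → Expr n → Vector Carrier n → Carrier
  ⟦ var i ⟧   w = w i
  ⟦ const a ⟧ w = ι a
  ⟦ e ⊕ f ⟧   w = ⟦ e ⟧ w + ⟦ f ⟧ w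
  ⟦ e ⊗ f ⟧   w = ⟦ e ⟧ w * ⟦ f ⟧ w
  ⟦ ⊖ e ⟧     w = - ⟦ e ⟧ w

  ⟦⟧-cong : ∀ {n} (e : Expr n) {v w} → (∀ i → v i ≈ w i) → ⟦ e ⟧ v ≈ ⟦ e ⟧ w
  ⟦⟧-cong (var i)   v≈w = v≈w i
  ⟦⟧-cong (const a) v≈w = refl
  ⟦⟧-cong (e ⊕ f)   v≈w = +-cong (⟦⟧-cong e v≈w) (⟦⟧-cong f v≈w)
  ⟦⟧-cong (e ⊗ f)   v≈w = *-cong (⟦⟧-cong e v≈w) (⟦⟧-cong f v≈w)
  ⟦⟧-cong (⊖ e)     v≈w = -‿cong (⟦⟧-cong e v≈w)

  rename : ∀ {m n} → (Fin n → Fin m) → Expr n → Expr m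
  rename f (var i)   = var (f i)
  rename f (const a) = const a
  rename f (d ⊕ e)   = rename f d ⊕ rename f e
  rename f (d ⊗ e)   = rename f d ⊗ rename f e
  rename f (⊖ e)     = ⊖ rename f e

  ⟦rename⟧ : ∀ {m n} (f : Fin n → Fin m) e w → ⟦ rename f e ⟧ w ≡ ⟦ e ⟧ (w ∘ f)
  ⟦rename⟧ f (var i)   w = ≡.refl
  ⟦rename⟧ f (const a) w = ≡.refl
  ⟦rename⟧ f (d ⊕ e)   w = ≡.cong₂ _+_ (⟦rename⟧ f d w) (⟦rename⟧ f e w)
  ⟦rename⟧ f (d ⊗ e)   w = ≡.cong₂ _*_ (⟦rename⟧ f d w) (⟦rename⟧ f e w)
  ⟦rename⟧ f (⊖ e)     w = ≡.cong -_ (⟦rename⟧ f e w)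

  private
    Poly : ℕ → Set c
    Poly = Terms k L ι

    ev : ∀ {n} → Vector Carrier n → Poly n → Carrier
    ev = evaluate k L ι

    mono : ∀ {n} → Vector Carrier n → Vec ℕ n → Carrier
    mono = monomial k L ι

    term : ∀ {n} → Vector Carrier n → k.Carrier × Vec ℕ n → Carrier
    term w (a , α) = ι a * mono w α

    mono-suc : ∀ {n} (w : Vector Carrier n) i α → mono w (Vec.updateAt α i suc) ≈ w i * mono w α
    mono-suc w zero    (a Vec.∷ α) = *-assoc _ _ _
    mono-suc w (suc i) (a Vec.∷ α) = trans (*-congˡ (mono-suc (tail w) i α))
      (solve 3 (λ p q r → p :* (q :* r) := q :* (p :* r)) refl _ _ _)

    mono-0 : ∀ {n} (w : Vector Carrier n) → mono w (Vec.replicate n 0) ≈ 1#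
    mono-0 {zero}  w = refl
    mono-0 {suc n} w = trans (*-identityˡ _) (mono-0 (tail w))

    ev-++ : ∀ {n} (w : Vector Carrier n) p q → ev w (p ++ q) ≈ ev w p + ev w q
    ev-++ w []      q = sym (+-identityˡ _)
    ev-++ w (t ∷ p) q = trans (+-congˡ (ev-++ w p q)) (sym (+-assoc _ _ _))

    ev-map : ∀ {n} (w : Vector Carrier n) f a → (∀ t → term w (f t) ≈ a * term w t) → ∀ p → ev w (map f p) ≈ a * ev w p
    ev-map w f a f≈a []      = sym (zeroʳ a)
    ev-map w f a f≈a (t ∷ p) = trans (+-cong (f≈a t) (ev-map w f a f≈a p)) (sym (distribˡ a _ _))

    scale : ∀ {n} → k.Carrier → k.Carrier × Vec ℕ n → k.Carrier × Vec ℕ n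
    scale a (b , α) = a k.* b , α

    ev-scale : ∀ {n} (w : Vector Carrier n) a p → ev w (map (scale a) p) ≈ ι a * ev w p
    ev-scale w a = ev-map w (scale a) (ι a) λ (b , α) → trans (*-congʳ (ι.*-homo a b)) (*-assoc _ _ _)

    -- Multiplying an accumulated list of terms by e avoids a product of two term lists: `_⊗_`
    -- becomes two successive multiplications.
    times : ∀ {n} → Expr n → Poly n → Poly n
    times (var i)   p = map (λ (a , α) → a , Vec.updateAt α i suc) p
    times (const a) p = map (scale a) p
    times (e ⊕ f)   p = times e p ++ times f p
    times (e ⊗ f)   p = times e (times f p)
    times (⊖ e)     p = map (scale (k.- k.1#)) (times e p)

    ev-times : ∀ {n} (w : Vector Carrier n) e p → ev w (times e p) ≈ ⟦ e ⟧ w * ev w p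
    ev-times w (var i)   p = ev-map w (λ (a , α) → a , Vec.updateAt α i suc) (w i)
      (λ (a , α) → trans (*-congˡ (mono-suc w i α)) (solve 3 (λ p q r → p :* (q :* r) := q :* (p :* r)) refl (ι a) (w i) (mono w α))) p
    ev-times w (const a) p = ev-scale w a p
    ev-times w (e ⊕ f)   p = trans (ev-++ w (times e p) (times f p))
      (trans (+-cong (ev-times w e p) (ev-times w f p)) (sym (distribʳ (ev w p) _ _)))
    ev-times w (e ⊗ f)   p = trans (ev-times w e (times f p)) (trans (*-congˡ (ev-times w f p)) (sym (*-assoc _ _ _)))
    ev-times w (⊖ e)     p = begin
      ev w (map (scale (k.- k.1#)) (times e p))   ≈⟨ ev-scale w (k.- k.1#) (times e p) ⟩
      ι (k.- k.1#) * ev w (times e p)             ≈⟨ *-cong (trans (ι.-‿homo k.1#) (-‿cong ι.1#-homo)) (ev-times w e p) ⟩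
      - 1# * (⟦ e ⟧ w * ev w p)                   ≈⟨ -1*x≈-x _ ⟩
      - (⟦ e ⟧ w * ev w p)                        ≈⟨ -‿distribˡ-* _ _ ⟩
      - ⟦ e ⟧ w * ev w p                          ∎

    -- Only exponent vectors are compared. A coefficient that cancels to zero stays in the list, as
    -- equality in k cannot be decided.
    insert : ∀ {n} → k.Carrier × Vec ℕ n → Poly n → Poly n
    insert (a , α) [] = (a , α) ∷ []
    insert (a , α) ((b , β) ∷ p) with ≡-dec ℕ._≟_ α β
    ... | yes _ = (a k.+ b , β) ∷ p
    ... | no  _ = (b , β) ∷ insert (a , α) p

    collect : ∀ {n} → Poly n → Poly n
    collect []      = []
    collect (t ∷ p) = insert t (collect p)

    ev-insert : ∀ {n} (w : Vector Carrier n) t p → ev w (insert t p) ≈ term w t + ev w p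
    ev-insert w (a , α) [] = refl
    ev-insert w (a , α) ((b , β) ∷ p) with ≡-dec ℕ._≟_ α β
    ... | yes ≡.refl = trans (+-congʳ (trans (*-congʳ (ι.+-homo a b)) (distribʳ (mono w α) (ι a) (ι b)))) (+-assoc _ _ _)
    ... | no  _      = trans (+-congˡ (ev-insert w (a , α) p)) (solve 3 (λ p q r → p :+ (q :+ r) := q :+ (p :+ r)) refl _ _ _)

    ev-collect : ∀ {n} (w : Vector Carrier n) p → ev w (collect p) ≈ ev w p
    ev-collect w []      = refl
    ev-collect w (t ∷ p) = trans (ev-insert w t (collect p)) (+-congˡ (ev-collect w p))

    insert-fresh : ∀ {n} {β : Vec ℕ n} t p → β ≢ proj₂ t → All (β ≢_) (map proj₂ p) → All (β ≢_) (map proj₂ (insert t p))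
    insert-fresh t [] β≢ [] = β≢ ∷ []
    insert-fresh (a , α) ((b , γ) ∷ p) β≢ (β≢γ ∷ fresh) with ≡-dec ℕ._≟_ α γ
    ... | yes _ = β≢γ ∷ fresh
    ... | no  _ = β≢γ ∷ insert-fresh (a , α) p β≢ fresh

    insert-unique : ∀ {n} t (p : Poly n) → Unique (map proj₂ p) → Unique (map proj₂ (insert t p))
    insert-unique t [] [] = [] ∷ []
    insert-unique (a , α) ((b , β) ∷ p) (fresh ∷ unique) with ≡-dec ℕ._≟_ α β
    ... | yes _  = fresh ∷ unique
    ... | no α≢β = insert-fresh (a , α) p (α≢β ∘ ≡.sym) fresh ∷ insert-unique (a , α) p unique

    collect-unique : ∀ {n} (p : Poly n) → Unique (map proj₂ (collect p))
    collect-unique []      = []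
    collect-unique (t ∷ p) = insert-unique t (collect p) (collect-unique p)

    ev-0 : ∀ {n} (w : Vector Carrier n) {p} → All (λ t → proj₁ t k.≈ k.0#) p → ev w p ≈ 0#
    ev-0 w []         = refl
    ev-0 w (a≈0 ∷ p≈0) = trans (+-cong (trans (*-congʳ (trans (ι.⟦⟧-cong a≈0) ι.0#-homo)) (zeroˡ _)) (ev-0 w p≈0)) (+-identityˡ 0#)

    terms : ∀ {n} → Expr n → Poly n
    terms {n} e = times e ((k.1# , Vec.replicate n 0) ∷ [])

    ev-terms : ∀ {n} (w : Vector Carrier n) e → ev w (terms e) ≈ ⟦ e ⟧ w
    ev-terms w e = begin
      ev w (terms e)                                        ≈⟨ ev-times w e _ ⟩
      ⟦ e ⟧ w * (ι k.1# * mono w (Vec.replicate _ 0) + 0#)  ≈⟨ *-congˡ (trans (+-identityʳ _) (*-cong ι.1#-homo (mono-0 w))) ⟩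
      ⟦ e ⟧ w * (1# * 1#)                                   ≈⟨ trans (*-congˡ (*-identityˡ 1#)) (*-identityʳ _) ⟩
      ⟦ e ⟧ w                                               ∎

  -- Algebraic independence, in the form in which it is used: a polynomial relation
  -- between the entries of v may be specialised.
  Generic : ∀ {n} → Vector Carrier n → Set (c ⊔ c′ ⊔ ℓ′)
  Generic {n} v = (e : Expr n) → ⟦ e ⟧ v ≈ 0# → ∀ w → ⟦ e ⟧ w ≈ 0#

  -- Once like terms are collected, independence makes every coefficient vanish, and the
  -- coefficients do not depend on the point of evaluation.
  independent⇒generic : ∀ {n} {v : Vector Carrier n} → AlgebraicallyIndependent k L ι v → Generic v
  independent⇒generic {v = v} independent e ev≈0 w = begin
    ⟦ e ⟧ w                   ≈⟨ ev-terms w e ⟨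
    ev w (terms e)            ≈⟨ ev-collect w (terms e) ⟨
    ev w (collect (terms e))  ≈⟨ ev-0 w (independent (collect (terms e)) (collect-unique (terms e))
                                   (trans (ev-collect v (terms e)) (trans (ev-terms v e) ev≈0))) ⟩
    0#                        ∎

  -- To specialise `v ∘ f` at w, the whole family v is specialised at `w ∘ r`. This covers
  -- subfamilies as well as permutations of the variables.
  generic-∘ : ∀ {m n} {v : Vector Carrier m} → Generic v → (f : Fin n → Fin m) (r : Fin m → Fin n) →
    (∀ i → r (f i) ≡ i) → Generic (v ∘ f)
  generic-∘ {v = v} generic f r r∘f≗id e e≈0 w = begin
    ⟦ e ⟧ w                   ≈⟨ ⟦⟧-cong e (λ i → reflexive (≡.cong w (≡.sym (r∘f≗id i)))) ⟩
    ⟦ e ⟧ (w ∘ r ∘ f)         ≡⟨ ⟦rename⟧ f e (w ∘ r) ⟨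
    ⟦ rename f e ⟧ (w ∘ r)    ≈⟨ generic (rename f e) (trans (reflexive (⟦rename⟧ f e v)) e≈0) (w ∘ r) ⟩
    0#                        ∎

  PolynomialFunction : ∀ {n} → (Vector Carrier n → Carrier) → Set (c ⊔ c′ ⊔ ℓ′)
  PolynomialFunction φ = ∃[ e ] ∀ w → ⟦ e ⟧ w ≈ φ w

  -- With φ an arbitrary function known to be polynomial, genericity applies directly to `δ` and to
  -- power sums, without writing out their expressions.
  specialise : ∀ {n} {v : Vector Carrier n} → Generic v → ∀ {φ} → PolynomialFunction φ → φ v ≈ 0# → ∀ w → φ w ≈ 0#
  specialise {v = v} generic (e , e≈φ) φv≈0 w = trans (sym (e≈φ w)) (generic e (trans (e≈φ v) φv≈0) w)

  module _ {n : ℕ} where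

    coordinate : ∀ i → PolynomialFunction {n} (λ w → w i)
    coordinate i = var i , λ w → refl

    one : PolynomialFunction {n} (λ w → 1#)
    one = const k.1# , λ w → ι.1#-homo

    plus : ∀ {φ ψ : Vector Carrier n → Carrier} → PolynomialFunction φ → PolynomialFunction ψ → PolynomialFunction (λ w → φ w + ψ w)
    plus (e , e≈) (f , f≈) = e ⊕ f , λ w → +-cong (e≈ w) (f≈ w)

    minus : ∀ {φ ψ : Vector Carrier n → Carrier} → PolynomialFunction φ → PolynomialFunction ψ → PolynomialFunction (λ w → φ w - ψ w)
    minus (e , e≈) (f , f≈) = e ⊕ ⊖ f , λ w → +-cong (e≈ w) (-‿cong (f≈ w))

    mult : ∀ {φ ψ : Vector Carrier n → Carrier} → PolynomialFunction φ → PolynomialFunction ψ → PolynomialFunction (λ w → φ w * ψ w)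
    mult (e , e≈) (f , f≈) = e ⊗ f , λ w → *-cong (e≈ w) (f≈ w)

    power : ∀ {φ : Vector Carrier n → Carrier} m → PolynomialFunction φ → PolynomialFunction (λ w → φ w ^ m)
    power zero    φ∈ = one
    power (suc m) φ∈ = mult φ∈ (power m φ∈)

    summation : ∀ {m} {φ : Fin m → Vector Carrier n → Carrier} → (∀ i → PolynomialFunction (φ i)) → PolynomialFunction (λ w → sum λ i → φ i w)
    summation {zero}  φ∈ = const k.0# , λ w → ι.0#-homo
    summation {suc m} φ∈ = plus (φ∈ zero) (summation (φ∈ ∘ suc))

    prod : ∀ {m} {φ : Fin m → Vector Carrier n → Carrier} → (∀ i → PolynomialFunction (φ i)) → PolynomialFunction (λ w → product λ i → φ i w)
    prod {zero}  φ∈ = one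
    prod {suc m} φ∈ = mult (φ∈ zero) (prod (φ∈ ∘ suc))

-- Equivalent to n ≥ 3, apart from the vacuous case n = 0.
ThreeElements : ℕ → Set
ThreeElements n = (a b : Fin n) → ∃[ c ] c ≢ a × c ≢ b

three-elements : ∀ {n} → ThreeElements (3 ℕ.+ n)
three-elements zero          zero          = suc zero , (λ ()) , (λ ())
three-elements zero          (suc zero)    = suc (suc zero) , (λ ()) , (λ ())
three-elements zero          (suc (suc b)) = suc zero , (λ ()) , (λ ())
three-elements (suc zero)    zero          = suc (suc zero) , (λ ()) , (λ ())
three-elements (suc (suc a)) zero          = suc zero , (λ ()) , (λ ())
three-elements (suc a)       (suc b)       = zero , (λ ()) , (λ ())

-- Nonvanishing by specialisation.

module GenericVectors {c ℓ c′ ℓ′} (k : Field c ℓ) (L : Field c′ ℓ′) (ι : Field.Carrier k → Field.Carrier L)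
                      (ι-homomorphism : IsRingHomomorphism (Field.rawRing k) (Field.rawRing L) ι) where
  open Field L hiding (zero)
  open Sums L
  open Polynomials L
  open Interpolation L
  open Expressions k L ι ι-homomorphism
  open RingProperties ring
  open SetoidReasoning setoid

  -- Used both as the point of specialisation and, in `sum-powers-C`, as the coefficient vector of
  -- the monomial Xᵃ.
  indicator : ∀ {n} → Fin n → Vector Carrier n
  indicator a i = if does (i Fin.≟ a) then 1# else 0#

  indicator-same : ∀ {n} (a : Fin n) → indicator a a ≈ 1#
  indicator-same a = reflexive (≡.cong (if_then 1# else 0#) (dec-true (a Fin.≟ a) ≡.refl))

  indicator-other : ∀ {n} {a i : Fin n} → i ≢ a → indicator a i ≈ 0#
  indicator-other {a = a} {i} i≢a = reflexive (≡.cong (if_then 1# else 0#) (dec-false (i Fin.≟ a) i≢a))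

  private
    indicator-≉ : ∀ {n} {a i : Fin n} → i ≢ a → indicator a i ≉ indicator a a
    indicator-≉ {a = a} i≢a eq = 0≉1 (trans (sym (indicator-other i≢a)) (trans eq (indicator-same a)))

    δ-indicator-same : ∀ {n} (a : Fin (suc n)) → δ (indicator a) a ≉ 0#
    δ-indicator-same a = product-≉0 _ λ b → ≉⇒-≉0 (indicator-≉ (punchInᵢ≢i a b))

    -- An index c different from a and b contributes the factor 0 - 0 to the product.
    δ-indicator-other : ∀ {n} → ThreeElements (suc n) → {a b : Fin (suc n)} → b ≢ a → δ (indicator a) b ≈ 0#
    δ-indicator-other third {a} {b} b≢a with third a b
    ... | c , c≢a , c≢b = product-≈0 (λ i → removeAt (indicator a) b i - indicator a b) (punchOut (c≢b ∘ ≡.sym)) (begin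
      removeAt (indicator a) b (punchOut (c≢b ∘ ≡.sym)) - indicator a b
        ≈⟨ +-cong (trans (removeAt-punchOut (indicator a) (c≢b ∘ ≡.sym)) (indicator-other c≢a)) (-‿cong (indicator-other b≢a)) ⟩
      0# - 0#
        ≈⟨ -‿inverseʳ 0# ⟩
      0# ∎)

    δ-function : ∀ {n} l → PolynomialFunction {suc n} (λ w → δ w l)
    δ-function l = prod λ b → minus (coordinate (punchIn l b)) (coordinate l)

  module _ {n} {v : Vector Carrier n} (generic : Generic v) where

    generic⇒distinct : Distinct v
    generic⇒distinct {i} {j} i≢j vi≈vj = indicator-≉ {a = i} (i≢j ∘ ≡.sym)
      (sym (x∙y⁻¹≈ε⇒x≈y _ _ (specialise generic (minus (coordinate i) (coordinate j)) (x≈y⇒x∙y⁻¹≈ε vi≈vj) (indicator i))))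

  -- At a vector with a single entry 1 the power sum equals 1, in every characteristic. The exponent
  -- is positive because the sum of the zeroth powers is the integer n, which may vanish in the
  -- field.
  power-sum≉0 : ∀ {n} {v : Vector Carrier (suc n)} → Generic v → ∀ m → (sum λ i → v i ^ suc m) ≉ 0#
  power-sum≉0 {n} generic m p≈0 = ^-≉0 (suc m) (0≉1 ∘ sym ∘ trans (sym (indicator-same {suc n} zero))) (begin
    indicator {suc n} zero zero ^ suc m
      ≈⟨ sum-single (λ i → indicator {suc n} zero i ^ suc m) zero (λ i i≢0 → trans (*-congʳ (indicator-other i≢0)) (zeroˡ _)) ⟨
    (sum λ i → indicator {suc n} zero i ^ suc m)
      ≈⟨ specialise generic (summation λ i → power (suc m) (coordinate i)) p≈0 (indicator zero) ⟩
    0# ∎)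

  module _ {n} (third : ThreeElements (suc n)) {v : Vector Carrier (suc n)} (generic : Generic v) where

    -- At `indicator i` the entry `δ v i` becomes nonzero while `δ v j` becomes zero.
    generic⇒δ-distinct : Distinct (δ v)
    generic⇒δ-distinct {i} {j} i≢j δi≈δj = δ-indicator-same i (trans
      (x∙y⁻¹≈ε⇒x≈y _ _ (specialise generic (minus (δ-function i) (δ-function j)) (x≈y⇒x∙y⁻¹≈ε δi≈δj) (indicator i)))
      (δ-indicator-other third (i≢j ∘ ≡.sym)))

    -- At `indicator zero` a single summand survives, and it is nonzero.
    sum-δ≉0 : sum (δ v) ≉ 0#
    sum-δ≉0 Σδ≈0 = δ-indicator-same {n} zero (trans
      (sym (sum-single (δ e₀) zero λ i → δ-indicator-other third))
      (specialise generic {λ w → sum (δ w)} (summation {φ = λ l w → δ w l} δ-function) Σδ≈0 e₀))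
      where
      e₀ : Vector Carrier (suc n)
      e₀ = indicator zero

-- Automorphisms obtained by permuting the variables.

module Substitution {c ℓ c′ ℓ′} {k : Field c ℓ} {m : ℕ} (E : RationalFunctionField k m c′ ℓ′) where
  open RationalFunctionField E hiding (zero)
  private
    module ι = IsRingHomomorphism ι-homomorphism
  open FieldProperties L
  open Sums L
  open Endomorphisms L
  open Expressions k L ι ι-homomorphism using (Expr; var; const; _⊕_; _⊗_; ⊖_; ⟦_⟧; Generic; generic-∘; independent⇒generic)
  open RingProperties ring
  open SetoidReasoning setoid

  variables-generic : Generic variables
  variables-generic = independent⇒generic independent

  record Fraction (a : Carrier) : Set (c ⊔ c′ ⊔ ℓ′) where
    field
      numerator denominator : Expr m
      denominator≉0 : ⟦ denominator ⟧ variables ≉ 0#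
      quotient      : a * ⟦ denominator ⟧ variables ≈ ⟦ numerator ⟧ variables

  open Fraction

  one : Expr m
  one = const (Field.1# k)

  private
    polynomial : ∀ {a} (e : Expr m) → a ≈ ⟦ e ⟧ variables → Fraction a
    polynomial e a≈e = record
      { numerator     = e
      ; denominator   = one
      ; denominator≉0 = λ ι1≈0 → 0≉1 (trans (sym ι1≈0) ι.1#-homo)
      ; quotient      = trans (*-cong a≈e ι.1#-homo) (*-identityʳ _)
      }

  fraction : ∀ {a} → a ∈ Adjoin L (Values L ι) (Values L variables) → Fraction a
  fraction (generator (inj₁ (b , a≈ιb))) = polynomial (const b) a≈ιb
  fraction (generator (inj₂ (i , a≈zi))) = polynomial (var i) a≈zi
  fraction (≈-closed a≈b a∈) = record
    { numerator = numerator p; denominator = denominator p; denominator≉0 = denominator≉0 p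
    ; quotient = trans (*-congʳ (sym a≈b)) (quotient p) }
    where p = fraction a∈
  fraction zero-closed = polynomial (const (Field.0# k)) (sym ι.0#-homo)
  fraction one-closed = polynomial one (sym ι.1#-homo)
  fraction (add-closed {a} {b} a∈ b∈) = record
    { numerator     = numerator p ⊗ denominator q ⊕ numerator q ⊗ denominator p
    ; denominator   = denominator p ⊗ denominator q
    ; denominator≉0 = *-≉0 (denominator≉0 p) (denominator≉0 q)
    ; quotient      = trans
        (solve 4 (λ a b d e → (a :+ b) :* (d :* e) := (a :* d) :* e :+ (b :* e) :* d) refl a b _ _)
        (+-cong (*-congʳ (quotient p)) (*-congʳ (quotient q)))
    }
    where p = fraction a∈; q = fraction b∈
  fraction (mul-closed {a} {b} a∈ b∈) = record
    { numerator     = numerator p ⊗ numerator q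
    ; denominator   = denominator p ⊗ denominator q
    ; denominator≉0 = *-≉0 (denominator≉0 p) (denominator≉0 q)
    ; quotient      = trans
        (solve 4 (λ a b d e → (a :* b) :* (d :* e) := (a :* d) :* (b :* e)) refl a b _ _)
        (*-cong (quotient p) (quotient q))
    }
    where p = fraction a∈; q = fraction b∈
  fraction (neg-closed a∈) = record
    { numerator = ⊖ numerator p; denominator = denominator p; denominator≉0 = denominator≉0 p
    ; quotient = trans (sym (-‿distribˡ-* _ _)) (-‿cong (quotient p)) }
    where p = fraction a∈
  fraction (inv-closed {a} {b} a∈ ab≈1) = record
    { numerator     = denominator p
    ; denominator   = numerator p
    ; denominator≉0 = *-≉0 (unit⇒≉0 ab≈1) (denominator≉0 p) ∘ trans (quotient p)
    ; quotient      = begin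
        b * ⟦ numerator p ⟧ variables           ≈⟨ *-congˡ (quotient p) ⟨
        b * (a * ⟦ denominator p ⟧ variables)   ≈⟨ solve 3 (λ a b d → b :* (a :* d) := (a :* b) :* d) refl a b _ ⟩
        (a * b) * ⟦ denominator p ⟧ variables   ≈⟨ *-congʳ ab≈1 ⟩
        1# * ⟦ denominator p ⟧ variables        ≈⟨ *-identityˡ _ ⟩
        ⟦ denominator p ⟧ variables             ∎
    }
    where p = fraction a∈

  module _ {ζ : Vector Carrier m} (ζ-generic : Generic ζ) where

    -- Genericity is used in both directions: that of the variables carries relations over to ζ,
    -- while that of ζ keeps denominators from vanishing.
    generic-≉0 : ∀ e → ⟦ e ⟧ variables ≉ 0# → ⟦ e ⟧ ζ ≉ 0#
    generic-≉0 e e≉0 eζ≈0 = e≉0 (ζ-generic e eζ≈0 variables)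

    private
      num den : Carrier → Expr m
      num a = numerator (fraction (generated a))
      den a = denominator (fraction (generated a))

      den≉0 : ∀ a → ⟦ den a ⟧ ζ ≉ 0#
      den≉0 a = generic-≉0 (den a) (denominator≉0 (fraction (generated a)))

    -- The fraction is read off the derivation `generated a`, so equal elements may receive
    -- different fractions. That the result respects equality is proved afterwards, through
    -- `substitute-unique`.
    substitute : Carrier → Carrier
    substitute a = ⟦ num a ⟧ ζ * proj₁ (invertible (⟦ den a ⟧ ζ) (den≉0 a))

    private
      substitute-den : ∀ a → substitute a * ⟦ den a ⟧ ζ ≈ ⟦ num a ⟧ ζ
      substitute-den a with invertible (⟦ den a ⟧ ζ) (den≉0 a)
      ... | b , db≈1 = begin
        (⟦ num a ⟧ ζ * b) * ⟦ den a ⟧ ζ   ≈⟨ solve 3 (λ n b d → (n :* b) :* d := n :* (d :* b)) refl _ b _ ⟩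
        ⟦ num a ⟧ ζ * (⟦ den a ⟧ ζ * b)   ≈⟨ *-congˡ db≈1 ⟩
        ⟦ num a ⟧ ζ * 1#                  ≈⟨ *-identityʳ _ ⟩
        ⟦ num a ⟧ ζ                       ∎

    -- Any fraction representing a may be used: its equality with the chosen one, multiplied out, is
    -- a polynomial relation between the variables and therefore persists at ζ.
    substitute-quotient : ∀ {a} d e → a * ⟦ d ⟧ variables ≈ ⟦ e ⟧ variables → substitute a * ⟦ d ⟧ ζ ≈ ⟦ e ⟧ ζ
    substitute-quotient {a} d e ad≈e = *-cancelˡ-≉0 (den≉0 a) (begin
      ⟦ den a ⟧ ζ * (substitute a * ⟦ d ⟧ ζ)   ≈⟨ solve 3 (λ x s d → x :* (s :* d) := (s :* x) :* d) refl _ _ _ ⟩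
      (substitute a * ⟦ den a ⟧ ζ) * ⟦ d ⟧ ζ   ≈⟨ *-congʳ (substitute-den a) ⟩
      ⟦ num a ⟧ ζ * ⟦ d ⟧ ζ                    ≈⟨ x∙y⁻¹≈ε⇒x≈y _ _ (ζ-relation) ⟩
      ⟦ den a ⟧ ζ * ⟦ e ⟧ ζ                    ∎)
      where
      relation : ⟦ num a ⟧ variables * ⟦ d ⟧ variables ≈ ⟦ den a ⟧ variables * ⟦ e ⟧ variables
      relation = begin
        ⟦ num a ⟧ variables * ⟦ d ⟧ variables        ≈⟨ *-congʳ (quotient (fraction (generated a))) ⟨
        (a * ⟦ den a ⟧ variables) * ⟦ d ⟧ variables  ≈⟨ solve 3 (λ a x d → (a :* x) :* d := x :* (a :* d)) refl a _ _ ⟩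
        ⟦ den a ⟧ variables * (a * ⟦ d ⟧ variables)  ≈⟨ *-congˡ ad≈e ⟩
        ⟦ den a ⟧ variables * ⟦ e ⟧ variables        ∎
      ζ-relation : ⟦ num a ⊗ d ⊕ ⊖ (den a ⊗ e) ⟧ ζ ≈ 0#
      ζ-relation = variables-generic (num a ⊗ d ⊕ ⊖ (den a ⊗ e)) (x≈y⇒x∙y⁻¹≈ε relation) ζ

    private
      substitute-polynomial : ∀ {a} e → a ≈ ⟦ e ⟧ variables → substitute a ≈ ⟦ e ⟧ ζ
      substitute-polynomial {a} e a≈e = begin
        substitute a              ≈⟨ *-identityʳ _ ⟨
        substitute a * 1#         ≈⟨ *-congˡ ι.1#-homo ⟨
        substitute a * ⟦ one ⟧ ζ  ≈⟨ substitute-quotient one e (trans (*-cong a≈e ι.1#-homo) (*-identityʳ _)) ⟩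
        ⟦ e ⟧ ζ                   ∎

    substitute-ι : ∀ b → substitute (ι b) ≈ ι b
    substitute-ι b = substitute-polynomial (const b) refl

    substitute-variable : ∀ i → substitute (variables i) ≈ ζ i
    substitute-variable i = substitute-polynomial (var i) refl

    private
      module Q (a : Carrier) = Fraction (fraction (generated a))

      substitute-unique : ∀ {a s} d e → ⟦ d ⟧ variables ≉ 0# → a * ⟦ d ⟧ variables ≈ ⟦ e ⟧ variables →
        s * ⟦ d ⟧ ζ ≈ ⟦ e ⟧ ζ → substitute a ≈ s
      substitute-unique {a} {s} d e d≉0 ad≈e sd≈e = *-cancelˡ-≉0 (generic-≉0 d d≉0) (begin
        ⟦ d ⟧ ζ * substitute a   ≈⟨ *-comm _ _ ⟩
        substitute a * ⟦ d ⟧ ζ   ≈⟨ substitute-quotient d e ad≈e ⟩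
        ⟦ e ⟧ ζ                  ≈⟨ sd≈e ⟨
        s * ⟦ d ⟧ ζ              ≈⟨ *-comm _ _ ⟩
        ⟦ d ⟧ ζ * s              ∎)

      substitute-cong : ∀ {a b} → a ≈ b → substitute a ≈ substitute b
      substitute-cong {a} {b} a≈b = substitute-unique (den b) (num b) (Q.denominator≉0 b)
        (trans (*-congʳ a≈b) (Q.quotient b)) (substitute-den b)

      substitute-+ : ∀ a b → substitute (a + b) ≈ substitute a + substitute b
      substitute-+ a b = substitute-unique (den a ⊗ den b) (num a ⊗ den b ⊕ num b ⊗ den a)
        (*-≉0 (Q.denominator≉0 a) (Q.denominator≉0 b))
        (trans (clear a b _ _) (+-cong (*-congʳ (Q.quotient a)) (*-congʳ (Q.quotient b))))
        (trans (clear _ _ _ _) (+-cong (*-congʳ (substitute-den a)) (*-congʳ (substitute-den b))))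
        where
        clear : ∀ a b d e → (a + b) * (d * e) ≈ (a * d) * e + (b * e) * d
        clear = solve 4 (λ a b d e → (a :+ b) :* (d :* e) := (a :* d) :* e :+ (b :* e) :* d) refl

      substitute-* : ∀ a b → substitute (a * b) ≈ substitute a * substitute b
      substitute-* a b = substitute-unique (den a ⊗ den b) (num a ⊗ num b)
        (*-≉0 (Q.denominator≉0 a) (Q.denominator≉0 b))
        (trans (clear a b _ _) (*-cong (Q.quotient a) (Q.quotient b)))
        (trans (clear _ _ _ _) (*-cong (substitute-den a) (substitute-den b)))
        where
        clear : ∀ a b d e → (a * b) * (d * e) ≈ (a * d) * (b * e)
        clear = solve 4 (λ a b d e → (a :* b) :* (d :* e) := (a :* d) :* (b :* e)) refl

      substitute-neg : ∀ a → substitute (- a) ≈ - substitute a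
      substitute-neg a = substitute-unique (den a) (⊖ num a) (Q.denominator≉0 a)
        (trans (sym (-‿distribˡ-* _ _)) (-‿cong (Q.quotient a)))
        (trans (sym (-‿distribˡ-* _ _)) (-‿cong (substitute-den a)))

    substitute-endomorphism : IsEndomorphism substitute
    substitute-endomorphism = record
      { isSemiringHomomorphism = record
        { isNearSemiringHomomorphism = record
          { +-isMonoidHomomorphism = record
            { isMagmaHomomorphism = record
              { isRelHomomorphism = record { cong = substitute-cong }
              ; homo = substitute-+ }
            ; ε-homo = trans (substitute-polynomial (const (Field.0# k)) (sym ι.0#-homo)) ι.0#-homo }
          ; *-homo = substitute-* }
        ; 1#-homo = trans (substitute-polynomial one (sym ι.1#-homo)) ι.1#-homo }
      ; -‿homo = substitute-neg }

  permuted-generic : (ρ : Permutation′ m) → Generic (variables ∘ (ρ ⟨$⟩ʳ_))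
  permuted-generic ρ = generic-∘ variables-generic (ρ ⟨$⟩ʳ_) (ρ Perm.⟨$⟩ˡ_) λ i → Perm.inverseˡ ρ

  permute : Permutation′ m → Carrier → Carrier
  permute ρ = substitute (permuted-generic ρ)

  permute-endomorphism : ∀ ρ → IsEndomorphism (permute ρ)
  permute-endomorphism ρ = substitute-endomorphism (permuted-generic ρ)

  permute-inverse : ∀ ρ τ → (∀ i → τ ⟨$⟩ʳ (ρ ⟨$⟩ʳ i) ≡ i) → ∀ a → permute τ (permute ρ a) ≈ a
  permute-inverse ρ τ τ∘ρ≗id a = fixes-generated
    (Composition.isRingHomomorphism trans (permute-endomorphism ρ) (permute-endomorphism τ)) fixed (generated a)
    where
    module τ = IsRingHomomorphism (permute-endomorphism τ)
    module ρ = IsRingHomomorphism (permute-endomorphism ρ)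
    fixed : ∀ {a} → a ∈ (Values L ι ∪ Values L variables) → permute τ (permute ρ a) ≈ a
    fixed {a} (inj₁ (b , a≈ιb)) = begin
      permute τ (permute ρ a)      ≈⟨ τ.⟦⟧-cong (ρ.⟦⟧-cong a≈ιb) ⟩
      permute τ (permute ρ (ι b))  ≈⟨ τ.⟦⟧-cong (substitute-ι (permuted-generic ρ) b) ⟩
      permute τ (ι b)              ≈⟨ substitute-ι (permuted-generic τ) b ⟩
      ι b                          ≈⟨ a≈ιb ⟨
      a                            ∎
    fixed {a} (inj₂ (i , a≈zi)) = begin
      permute τ (permute ρ a)               ≈⟨ τ.⟦⟧-cong (ρ.⟦⟧-cong a≈zi) ⟩
      permute τ (permute ρ (variables i))   ≈⟨ τ.⟦⟧-cong (substitute-variable (permuted-generic ρ) i) ⟩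
      permute τ (variables (ρ ⟨$⟩ʳ i))      ≈⟨ substitute-variable (permuted-generic τ) (ρ ⟨$⟩ʳ i) ⟩
      variables (τ ⟨$⟩ʳ (ρ ⟨$⟩ʳ i))         ≡⟨ ≡.cong variables (τ∘ρ≗id i) ⟩
      variables i                           ≈⟨ a≈zi ⟨
      a                                     ∎

  permute-automorphism : ∀ ρ → IsRingIsomorphism rawRing rawRing (permute ρ)
  permute-automorphism ρ = record
    { isRingMonomorphism = record
      { isRingHomomorphism = permute-endomorphism ρ
      ; injective = λ {a} {b} eq → trans (sym (left a)) (trans (τ.⟦⟧-cong eq) (left b)) }
    ; surjective = λ a → permute τ a , λ b≈τa → trans (ρ.⟦⟧-cong b≈τa) (right a) }
    where
    τ = Perm.flip ρ
    module τ = IsRingHomomorphism (permute-endomorphism τ)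
    module ρ = IsRingHomomorphism (permute-endomorphism ρ)
    left : ∀ a → permute τ (permute ρ a) ≈ a
    left = permute-inverse ρ τ λ i → Perm.inverseˡ ρ
    right : ∀ a → permute ρ (permute τ a) ≈ a
    right = permute-inverse τ ρ λ i → Perm.inverseʳ ρ

-- Transpositions and their effect on sums.

module Transpositions where

  transpose-fst : ∀ {n} (i j : Fin n) → Perm.transpose i j ⟨$⟩ʳ i ≡ j
  transpose-fst i j rewrite dec-true (i Fin.≟ i) ≡.refl = ≡.refl

  transpose-snd : ∀ {n} (i j : Fin n) → Perm.transpose i j ⟨$⟩ʳ j ≡ i
  transpose-snd i j with j Fin.≟ i
  ... | yes j≡i = j≡i
  ... | no  _ rewrite dec-true (j Fin.≟ j) ≡.refl = ≡.refl

  transpose-other : ∀ {n} {i j k : Fin n} → k ≢ i → k ≢ j → Perm.transpose i j ⟨$⟩ʳ k ≡ k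
  transpose-other {i = i} {j} {k} k≢i k≢j rewrite dec-false (k Fin.≟ i) k≢i | dec-false (k Fin.≟ j) k≢j = ≡.refl

  -- After i is moved to a, the image of j is exchanged with b; this leaves a in place, since a
  -- differs from both.
  two-transitive : ∀ {n} {i j a b : Fin n} → i ≢ j → a ≢ b →
    ∃[ τ ] τ ⟨$⟩ʳ i ≡ a × τ ⟨$⟩ʳ j ≡ b
  two-transitive {i = i} {j} {a} {b} i≢j a≢b = ρ Perm.∘ₚ Perm.transpose j′ b , i↦a , transpose-fst j′ b
    where
    ρ  = Perm.transpose i a
    j′ = ρ ⟨$⟩ʳ j
    a≢j′ : a ≢ j′
    a≢j′ a≡j′ = i≢j (Injection.injective (↔⇒↣ ρ) (≡.trans (transpose-fst i a) a≡j′))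
    i↦a : Perm.transpose j′ b ⟨$⟩ʳ (ρ ⟨$⟩ʳ i) ≡ a
    i↦a = ≡.trans (≡.cong (Perm.transpose j′ b ⟨$⟩ʳ_) (transpose-fst i a)) (transpose-other a≢j′ a≢b)

module _ {c ℓ} (L : Field c ℓ) where
  open Field L hiding (zero)
  open FieldProperties L
  open Sums L
  open Transpositions
  open SetoidReasoning setoid

  sum-transpose : ∀ {n} (v w : Vector Carrier n) {j k} → j ≢ k →
    (sum λ l → v l * w l) - (sum λ l → v (Perm.transpose j k ⟨$⟩ʳ l) * w l) ≈ (v j - v k) * (w j - w k)
  sum-transpose {n} v w {j} {k} j≢k = begin
    (sum λ l → v l * w l) - (sum λ l → v (π l) * w l)
      ≈⟨ sum-- (λ l → v l * w l) (λ l → v (π l) * w l) ⟩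
    sum f
      ≈⟨ sum-pair f j≢k (λ l l≢j l≢k → trans (+-congˡ (swapped (transpose-other l≢j l≢k))) (-‿inverseʳ _)) ⟩
    f j + f k
      ≈⟨ +-cong (+-congˡ (swapped (transpose-fst j k))) (+-congˡ (swapped (transpose-snd j k))) ⟩
    (v j * w j - v k * w j) + (v k * w k - v j * w k)
      ≈⟨ solve 4 (λ a b p q → (a :* p :- b :* p) :+ (b :* q :- a :* q) := (a :- b) :* (p :- q)) refl (v j) (v k) (w j) (w k) ⟩
    (v j - v k) * (w j - w k) ∎
    where
    π : Fin n → Fin n
    π = Perm.transpose j k ⟨$⟩ʳ_
    f : Vector Carrier n
    f l = v l * w l - v (π l) * w l
    swapped : ∀ {l l′} → π l ≡ l′ → - (v (π l) * w l) ≈ - (v l′ * w l)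
    swapped πl≡l′ = -‿cong (*-congʳ (reflexive (≡.cong v πl≡l′)))

-- Equivariance of interpolation under permutations.

module Equivariance {c ℓ} (L : Field c ℓ) where
  open Field L hiding (zero)
  open Sums L
  open Polynomials L
  open ElementarySymmetric L
  open Interpolation L
  open Endomorphisms L
  open SetoidReasoning setoid

  module _ {σ : Carrier → Carrier} (σ-endo : IsEndomorphism σ) where
    open IsRingHomomorphism σ-endo

    eval-homo : ∀ {n} (p : Vector Carrier n) X → σ (eval p X) ≈ eval (σ ∘ p) (σ X)
    eval-homo {zero}  p X = 0#-homo
    eval-homo {suc n} p X = trans (+-homo _ _) (+-congˡ (trans (*-homo _ _) (*-congˡ (eval-homo (tail p) X))))

    esym-homo : ∀ {n} (v : Vector Carrier n) j → σ (esym v j) ≈ esym (σ ∘ v) j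
    esym-homo {zero}  v zero    = 1#-homo
    esym-homo {zero}  v (suc j) = 0#-homo
    esym-homo {suc n} v zero    = esym-homo (tail v) zero
    esym-homo {suc n} v (suc j) = trans (+-homo _ _)
      (+-cong (esym-homo (tail v) (suc j)) (trans (*-homo _ _) (*-congˡ (esym-homo (tail v) j))))

    esym-fixed : ∀ {n} {v : Vector Carrier n} (π : Permutation′ n) → (∀ l → σ (v l) ≈ v (π ⟨$⟩ʳ l)) →
      ∀ j → σ (esym v j) ≈ esym v j
    esym-fixed {v = v} π σv≈vπ j = trans (esym-homo v j) (trans (esym-cong σv≈vπ j) (esym-permute v π j))

    module _ {p} {S : Pred Carrier p} (σ-fixes : ∀ {a} → a ∈ Generated L S → σ a ≈ a) where
      open Subfield L S

      -- One and the same polynomial yields every entry of φ, and σ fixes its coefficients.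
      polynomial-equivariant : ∀ {n} {v : Vector Carrier n} (π : Permutation′ n) → (∀ l → σ (v l) ≈ v (π ⟨$⟩ʳ l)) →
        ∀ {φ} → PolynomialIn v φ → ∀ l → σ (φ l) ≈ φ (π ⟨$⟩ʳ l)
      polynomial-equivariant π σv≈vπ (constant a∈F)     l = σ-fixes a∈F
      polynomial-equivariant π σv≈vπ coordinate         l = σv≈vπ l
      polynomial-equivariant π σv≈vπ (plus φ∈ ψ∈)       l =
        trans (+-homo _ _) (+-cong (polynomial-equivariant π σv≈vπ φ∈ l) (polynomial-equivariant π σv≈vπ ψ∈ l))
      polynomial-equivariant π σv≈vπ (mult φ∈ ψ∈)       l =
        trans (*-homo _ _) (*-cong (polynomial-equivariant π σv≈vπ φ∈ l) (polynomial-equivariant π σv≈vπ ψ∈ l))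
      polynomial-equivariant π σv≈vπ (respects φ≈ψ φ∈) l =
        trans (⟦⟧-cong (sym (φ≈ψ l))) (trans (polynomial-equivariant π σv≈vπ φ∈ l) (φ≈ψ (π ⟨$⟩ʳ l)))

      -- The inverse inside `weight` is merely some chosen inverse, so the claim is derived from
      -- `weight-δ`, both of whose other ingredients are polynomial in `x l`.
      weight-equivariant : ∀ {n} {x : Vector Carrier (suc n)} (distinct : Distinct x) (π : Permutation′ (suc n)) →
        (∀ j → esym x j ∈ F) → (∀ l → σ (x l) ≈ x (π ⟨$⟩ʳ l)) →
        ∀ i l → σ (weight x distinct i l) ≈ weight x distinct i (π ⟨$⟩ʳ l)
      weight-equivariant {x = x} distinct π esym∈F σx≈xπ i l = *-cancelˡ-≉0 (δ≉0 x distinct (π ⟨$⟩ʳ l)) (begin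
        δ x (π ⟨$⟩ʳ l) * σ (w l)             ≈⟨ *-comm _ _ ⟩
        σ (w l) * δ x (π ⟨$⟩ʳ l)             ≈⟨ *-congˡ (polynomial-equivariant π σx≈xπ (δ-polynomial x esym∈F) l) ⟨
        σ (w l) * σ (δ x l)                  ≈⟨ *-homo _ _ ⟨
        σ (w l * δ x l)                      ≈⟨ ⟦⟧-cong (weight-δ x distinct i l) ⟩
        σ (basis x l i)                      ≈⟨ polynomial-equivariant π σx≈xπ (basis-polynomial x esym∈F i) l ⟩
        basis x (π ⟨$⟩ʳ l) i                 ≈⟨ weight-δ x distinct i (π ⟨$⟩ʳ l) ⟨
        w (π ⟨$⟩ʳ l) * δ x (π ⟨$⟩ʳ l)        ≈⟨ *-comm _ _ ⟩
        δ x (π ⟨$⟩ʳ l) * w (π ⟨$⟩ʳ l)        ∎)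
        where w = weight x distinct i

-- The two sets of variables, the group and the solution of the system.

module TwoSetsProperties {c ℓ c′ ℓ′} {k : Field c ℓ} {n : ℕ}
  (E : RationalFunctionField k (n ℕ.+ n) c′ ℓ′)
  (u : Vector (RationalFunctionField.Carrier E) n) (u-solves : TwoSets.SolvesSystem n E u) where

  open RationalFunctionField E hiding (zero)
  open TwoSets n E
  open Polynomials L
  open ElementarySymmetric L
  open Endomorphisms L
  open Equivariance L
  open Expressions k L ι ι-homomorphism using (Generic; generic-∘)
  open GenericVectors k L ι ι-homomorphism
  open Substitution E
  open SetoidReasoning setoid

  private
    -- A common left inverse of the two embeddings, as `generic-∘` requires.
    index : Fin (n ℕ.+ n) → Fin n
    index = [ id , id ]′ ∘ splitAt n

  x-generic : Generic x
  x-generic = generic-∘ variables-generic (_↑ˡ n) index λ i → ≡.cong [ id , id ]′ (splitAt-↑ˡ n i n)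

  y-generic : Generic y
  y-generic = generic-∘ variables-generic (n ↑ʳ_) index λ i → ≡.cong [ id , id ]′ (splitAt-↑ʳ n n i)

  x-distinct : Distinct x
  x-distinct = generic⇒distinct x-generic

  K-generators : Pred Carrier (c ⊔ ℓ′)
  K-generators = Values L ι ∪ (Values L s ∪ Values L t)

  generated-⊆ : ∀ {p q} {S : Pred Carrier p} {T : Pred Carrier q} → S ⊆ Generated L T → Generated L S ⊆ Generated L T
  generated-⊆ S⊆ (generator a∈S)      = S⊆ a∈S
  generated-⊆ S⊆ (≈-closed a≈b a∈)    = ≈-closed a≈b (generated-⊆ S⊆ a∈)
  generated-⊆ S⊆ zero-closed          = zero-closed
  generated-⊆ S⊆ one-closed           = one-closed
  generated-⊆ S⊆ (add-closed a∈ b∈)   = add-closed (generated-⊆ S⊆ a∈) (generated-⊆ S⊆ b∈)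
  generated-⊆ S⊆ (mul-closed a∈ b∈)   = mul-closed (generated-⊆ S⊆ a∈) (generated-⊆ S⊆ b∈)
  generated-⊆ S⊆ (neg-closed a∈)      = neg-closed (generated-⊆ S⊆ a∈)
  generated-⊆ S⊆ (inv-closed a∈ ab≈1) = inv-closed (generated-⊆ S⊆ a∈) ab≈1

  private
    -- The generators cover the degrees 1 to n only, whereas division by 1 + aT is stated for whole
    -- sequences: degree 0 is 1, and degrees above n vanish.
    esym-closed : ∀ {p} {S : Pred Carrier p} (v : Vector Carrier n) →
      Values L (λ (i : Fin n) → elementary L (suc (toℕ i)) v) ⊆ Generated L S → ∀ j → esym v j ∈ Generated L S
    esym-closed v ⊆S zero = ≈-closed (sym (esym-zero v)) one-closed
    esym-closed v ⊆S (suc j) with j ℕ.<? n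
    ... | yes j<n = ≈-closed (elementary≈esym v (suc j))
      (⊆S (fromℕ< j<n , reflexive (≡.cong (λ j → elementary L (suc j) v) (≡.sym (toℕ-fromℕ< j<n)))))
    ... | no  j≮n = ≈-closed (sym (esym-high v (s≤s (ℕ.≮⇒≥ j≮n)))) zero-closed

  esym-x∈K : ∀ j → esym x j ∈ K
  esym-x∈K = esym-closed x (generator ∘ inj₂ ∘ inj₁)

  esym-y∈K : ∀ j → esym y j ∈ K
  esym-y∈K = esym-closed y (generator ∘ inj₂ ∘ inj₂)

  module _ (π₁ π₂ : Permutation′ n) where
    private
      ρ : Permutation′ (n ℕ.+ n)
      ρ = ↔-sym +↔⊎ ↔-∘ ((π₁ ⊎-↔ π₂) ↔-∘ +↔⊎)

      σ : Carrier → Carrier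
      σ = permute ρ

      σ-endo : IsEndomorphism σ
      σ-endo = permute-endomorphism ρ

    open IsRingHomomorphism σ-endo

    private
      permute-x : ∀ l → σ (x l) ≈ x (π₁ ⟨$⟩ʳ l)
      permute-x l = trans (substitute-variable (permuted-generic ρ) (l ↑ˡ n))
        (reflexive (≡.cong (variables ∘ join n n ∘ Sum.map (π₁ ⟨$⟩ʳ_) (π₂ ⟨$⟩ʳ_)) (splitAt-↑ˡ n l n)))

      permute-y : ∀ l → σ (y l) ≈ y (π₂ ⟨$⟩ʳ l)
      permute-y l = trans (substitute-variable (permuted-generic ρ) (n ↑ʳ l))
        (reflexive (≡.cong (variables ∘ join n n ∘ Sum.map (π₁ ⟨$⟩ʳ_) (π₂ ⟨$⟩ʳ_)) (splitAt-↑ʳ n n l)))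

      elementary-fixed : ∀ {v : Vector Carrier n} {a} (π : Permutation′ n) → (∀ l → σ (v l) ≈ v (π ⟨$⟩ʳ l)) →
        a ∈ Values L (λ (i : Fin n) → elementary L (suc (toℕ i)) v) → σ a ≈ a
      elementary-fixed {v} {a} π σv≈vπ (i , a≈e) = trans (⟦⟧-cong a≈esym) (trans (esym-fixed σ-endo π σv≈vπ (suc (toℕ i))) (sym a≈esym))
        where
        a≈esym : a ≈ esym v (suc (toℕ i))
        a≈esym = trans a≈e (elementary≈esym v (suc (toℕ i)))

      generators-fixed : ∀ {a} → a ∈ K-generators → σ a ≈ a
      generators-fixed (inj₁ (b , a≈ιb)) =
        trans (⟦⟧-cong a≈ιb) (trans (substitute-ι (permuted-generic ρ) b) (sym a≈ιb))
      generators-fixed (inj₂ (inj₁ a∈s)) = elementary-fixed π₁ permute-x a∈s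
      generators-fixed (inj₂ (inj₂ a∈t)) = elementary-fixed π₂ permute-y a∈t

    abstract
      -- The surjectivity half of `G` ≅ Sₙ × Sₙ.
      galois : ∃[ g ] (∀ l → x l ^ᴳ g ≈ x (π₁ ⟨$⟩ʳ l)) × (∀ l → y l ^ᴳ g ≈ y (π₂ ⟨$⟩ʳ l))
      galois = record
        { apply = σ
        ; isAutomorphism = permute-automorphism ρ
        ; fixes = fixes-generated σ-endo generators-fixed } , permute-x , permute-y

  module _ (g : G) where
    private
      module g = IsRingIsomorphism (Gal.isAutomorphism g)

    ^ᴳ-endomorphism : IsEndomorphism (_^ᴳ g)
    ^ᴳ-endomorphism = g.isRingHomomorphism

    ^ᴳ-cong : ∀ {a b} → a ≈ b → a ^ᴳ g ≈ b ^ᴳ g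
    ^ᴳ-cong = g.⟦⟧-cong

  eval-u : ∀ l → eval u (x l) ≈ y l
  eval-u l = trans (sym (sum≈eval u (x l))) (sym (u-solves l))

  eval-u^ : ∀ g {l l′ l″} → x l ^ᴳ g ≈ x l′ → y l ^ᴳ g ≈ y l″ → eval (λ j → u j ^ᴳ g) (x l′) ≈ y l″
  eval-u^ g {l} {l′} {l″} xl↦ yl↦ = begin
    eval (λ j → u j ^ᴳ g) (x l′)        ≈⟨ eval-cong {n} (λ _ → refl) xl↦ ⟨
    eval (λ j → u j ^ᴳ g) (x l ^ᴳ g)    ≈⟨ eval-homo (^ᴳ-endomorphism g) u (x l) ⟨
    eval u (x l) ^ᴳ g                   ≈⟨ ^ᴳ-cong g (eval-u l) ⟩
    y l ^ᴳ g                            ≈⟨ yl↦ ⟩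
    y l″                                ∎

  -- Applying h to the system only permutes its equations, and the solution is unique.
  H-fixes-u : ∀ {h} → h ∈ H → ∀ j → u j ^ᴳ h ≈ u j
  H-fixes-u {h} (π , permutes) = eval-injective x x-distinct (λ j → u j ^ᴳ h) u λ l → begin
    eval (λ j → u j ^ᴳ h) (x l)                               ≡⟨ ≡.cong (λ l → eval (λ j → u j ^ᴳ h) (x l)) (Perm.inverseʳ π) ⟨
    eval (λ j → u j ^ᴳ h) (x (π ⟨$⟩ʳ (π Perm.⟨$⟩ˡ l)))        ≈⟨ eval-u^ h (proj₁ (permutes _)) (proj₂ (permutes _)) ⟩
    y (π ⟨$⟩ʳ (π Perm.⟨$⟩ˡ l))                                ≡⟨ ≡.cong y (Perm.inverseʳ π) ⟩
    y l                                                       ≈⟨ eval-u l ⟨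
    eval u (x l)                                              ∎

  LₛLₜ-total : ∀ a → a ∈ LₛLₜ
  LₛLₜ-total a = generated-⊆ contained (generated a)
    where
    variable∈ : ∀ i → variables i ∈ LₛLₜ
    variable∈ i with splitAt n i | join-splitAt n n i
    ... | inj₁ l | ≡.refl = generator (inj₁ (generator (inj₂ (l , refl))))
    ... | inj₂ l | ≡.refl = generator (inj₂ (generator (inj₂ (l , refl))))
    contained : Values L ι ∪ Values L variables ⊆ LₛLₜ
    contained (inj₁ a∈ι)         = generator (inj₁ (generator (inj₁ (generator (inj₁ a∈ι)))))
    contained (inj₂ (i , a≈zi))  = ≈-closed (sym a≈zi) (variable∈ i)

-- The field generated by the conjugates.

module ConjugateField {c ℓ c′ ℓ′} {k : Field c ℓ} {m : ℕ} (third : ThreeElements (suc m))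
  (E : RationalFunctionField k (suc m ℕ.+ suc m) c′ ℓ′)
  (u : Vector (RationalFunctionField.Carrier E) (suc m)) (u-solves : TwoSets.SolvesSystem (suc m) E u)
  (i : Fin (suc m)) where

  n : ℕ
  n = suc m

  open RationalFunctionField E hiding (zero)
  open TwoSets n E
  open FieldProperties L
  open Sums L
  open Polynomials L
  open ElementarySymmetric L
  open Interpolation L
  open Equivariance L
  open GenericVectors k L ι ι-homomorphism
  open Transpositions
  open TwoSetsProperties E u u-solves
  open SemiringSum semiring using (sum-cong-≋; *-distribˡ-sum)
  open SetoidReasoning setoid
  open Subfield L (K ∪ Conjugates (u i))

  one : Fin n
  one = proj₁ (third zero zero)

  one≢0 : one ≢ zero
  one≢0 = proj₁ (proj₂ (third zero zero))

  K⊆F : K ⊆ F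
  K⊆F = generator ∘ inj₁

  -- `Conjugates` asks for a value common to the whole coset; it exists because elements of H fix
  -- `u i`.
  conjugate∈F : ∀ g → u i ^ᴳ g ∈ F
  conjugate∈F g = generator (inj₂ (g , λ where
    g′ (h , h∈H , g′≈hg) → trans (^ᴳ-cong g (sym (H-fixes-u {h} h∈H i))) (sym (g′≈hg (u i)))))

  abstract
    C : Vector Carrier n
    C = weight x x-distinct i

    C-δ : ∀ l → C l * δ x l ≈ basis x l i
    C-δ = weight-δ x x-distinct i

    C-interpolation : ∀ {w v : Vector Carrier n} → (∀ l → eval w (x l) ≈ v l) → w i ≈ sum λ l → v l * C l
    C-interpolation {w} {v} w-interpolates = interpolation x x-distinct {w} {v} w-interpolates i

    C-equivariant : ∀ g (π : Permutation′ n) → (∀ l → x l ^ᴳ g ≈ x (π ⟨$⟩ʳ l)) → ∀ l → C l ^ᴳ g ≈ C (π ⟨$⟩ʳ l)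
    C-equivariant g π x-permuted =
      weight-equivariant (^ᴳ-endomorphism g) (Gal.fixes g) x-distinct π esym-x∈K x-permuted i

  -- uᵢ conjugated by (id , τ) is the i-th coefficient of the polynomial with values y (τ l).
  permuted-sum∈F : ∀ (τ : Permutation′ n) → (sum λ l → y (τ ⟨$⟩ʳ l) * C l) ∈ F
  permuted-sum∈F τ = ≈-closed
    (C-interpolation {λ j → u j ^ᴳ g} {y ∘ (τ ⟨$⟩ʳ_)} λ l → eval-u^ g (x-fixed l) (y-permuted l))
    (conjugate∈F g)
    where
    g = proj₁ (galois Perm.id τ)
    x-fixed = proj₁ (proj₂ (galois Perm.id τ))
    y-permuted = proj₂ (proj₂ (galois Perm.id τ))

  -- With τ sending j to a and k to b, two conjugates whose values differ by the exchange of j and k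
  -- have sums that agree except in those two terms.
  differences∈F : ∀ {j k a b} → j ≢ k → a ≢ b → (y a - y b) * (C j - C k) ∈ F
  differences∈F {j} {k} j≢k a≢b with two-transitive j≢k a≢b
  ... | τ , ≡.refl , ≡.refl = ≈-closed (sum-transpose L (y ∘ (τ ⟨$⟩ʳ_)) C j≢k)
    (minus-closed (permuted-sum∈F τ) (permuted-sum∈F (Perm.transpose j k Perm.∘ₚ τ)))

  -- Exchanging `x k` and `x l` while fixing the y carries `C k` to `C l` and leaves `C j` alone.
  C-equal : ∀ {j k} → j ≢ k → C j ≈ C k → ∀ l → C l ≈ C j
  C-equal {j} {k} j≢k Cj≈Ck l with l Fin.≟ j
  ... | yes ≡.refl = refl
  ... | no  l≢j = sym (begin
    C j                 ≡⟨ ≡.cong C (transpose-other j≢k (l≢j ∘ ≡.sym)) ⟨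
    C (π ⟨$⟩ʳ j)        ≈⟨ moves j ⟨
    C j ^ᴳ g            ≈⟨ ^ᴳ-cong g Cj≈Ck ⟩
    C k ^ᴳ g            ≈⟨ moves k ⟩
    C (π ⟨$⟩ʳ k)        ≡⟨ ≡.cong C (transpose-fst k l) ⟩
    C l                 ∎)
    where
    π : Permutation′ n
    π = Perm.transpose k l
    g : G
    g = proj₁ (galois π Perm.id)
    moves : ∀ l → C l ^ᴳ g ≈ C (π ⟨$⟩ʳ l)
    moves = C-equivariant g π (proj₁ (proj₂ (galois π Perm.id)))

  -- Interpolating Xᵖ through its own values recovers Xᵖ, since p < n; the coefficient of Xⁱ is then
  -- compared.
  sum-powers-C : ∀ d → (∀ l → C l ≈ d) → ∀ p → (sum λ l → x l ^ toℕ p) * d ≈ indicator p i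
  sum-powers-C d C≈d p = begin
    (sum λ l → x l ^ toℕ p) * d                        ≈⟨ *-comm _ _ ⟩
    d * (sum λ l → x l ^ toℕ p)                        ≈⟨ *-distribˡ-sum d (λ l → x l ^ toℕ p) ⟩
    (sum λ l → d * x l ^ toℕ p)                        ≈⟨ sum-cong-≋ {n} (λ l → trans (*-congʳ (sym (C≈d l))) (*-comm (C l) (x l ^ toℕ p))) ⟩
    (sum λ l → x l ^ toℕ p * C l)                      ≈⟨ C-interpolation {indicator p} {λ l → x l ^ toℕ p} monomial-value ⟨
    indicator p i                                      ∎
    where
    monomial-value : ∀ l → eval (indicator p) (x l) ≈ x l ^ toℕ p
    monomial-value l = begin
      eval (indicator p) (x l)                         ≈⟨ sum≈eval (indicator p) (x l) ⟨
      (sum λ j → indicator p j * x l ^ toℕ j)          ≈⟨ sum-single (λ j → indicator p j * x l ^ toℕ j) p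
                                                            (λ j j≢p → trans (*-congʳ (indicator-other j≢p)) (zeroˡ _)) ⟩
      indicator p p * x l ^ toℕ p                      ≈⟨ trans (*-congʳ (indicator-same p)) (*-identityˡ _) ⟩
      x l ^ toℕ p                                      ∎

  -- If two weights agree then all of them equal some d, and dΣₗ xₗᵖ = δᵢₚ for
  -- p < n; this is absurd for a p ∉ {0, i}, which exists as n ≥ 3.
  C-distinct : Distinct C
  C-distinct {j} {k} j≢k Cj≈Ck with third zero i
  ... | zero  , p≢0 , p≢i = p≢0 ≡.refl
  -- The exponent i shows that the common value is a unit. For the exponent `suc p` its product with
  -- a nonzero power sum would be zero.
  ... | suc p , p≢0 , p≢i = *-≉0 (power-sum≉0 x-generic (toℕ p)) (unit⇒≉0 (trans (*-comm _ _) (trans (powers i) (indicator-same i))))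
      (trans (powers (suc p)) (indicator-other (p≢i ∘ ≡.sym)))
    where
    powers : ∀ p → (sum λ l → x l ^ toℕ p) * C j ≈ indicator p i
    powers = sum-powers-C (C j) (C-equal j≢k Cj≈Ck)

  private
    D : Carrier
    D = C zero - C one

    D≉0 : D ≉ 0#
    D≉0 = ≉⇒-≉0 (C-distinct (one≢0 ∘ ≡.sym))

  -- All m = n - 1 factors of `δ y a` are taken with the same pair of weights, so each brings the
  -- same D.
  δD∈F : ∀ a → δ y a * D ^ (m) ∈ F
  δD∈F a = ≈-closed (product-scale (λ b → removeAt y a b - y a))
    (product-closed λ b → differences∈F (one≢0 ∘ ≡.sym) (punchInᵢ≢i a b))
    where
    product-scale : ∀ {n} (v : Vector Carrier n) → (product λ b → v b * D) ≈ product v * D ^ n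
    product-scale {zero}  v = sym (*-identityˡ 1#)
    product-scale {suc n} v = trans (*-congˡ (product-scale (tail v)))
      (solve 4 (λ a d p q → (a :* d) :* (p :* q) := (a :* p) :* (d :* q)) refl (head v) D (product (tail v)) (D ^ n))

  esym-x∈F : ∀ j → esym x j ∈ F
  esym-x∈F = K⊆F ∘ esym-x∈K

  esym-y∈F : ∀ j → esym y j ∈ F
  esym-y∈F = K⊆F ∘ esym-y∈K

  D^∈F : D ^ (m) ∈ F
  D^∈F = cancel-closed (sum-δ≉0 third y-generic) (sum-polynomial-closed y esym-y∈F (δ-polynomial y esym-y∈F))
    (≈-closed (sym (trans (*-distribˡ-sum (D ^ m) (δ y)) (sum-cong-≋ {n} λ a → *-comm (D ^ m) (δ y a)))) (sum-closed δD∈F))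

  δ∈F : ∀ a → δ y a ∈ F
  δ∈F a = cancel-closed (^-≉0 (m) D≉0) D^∈F (δD∈F a)

  y∈F : ∀ l → y l ∈ F
  y∈F = separated y esym-y∈F (δ-polynomial y esym-y∈F) (constant one-closed) (δ y) δ∈F
    (λ l → sym (*-identityʳ _)) (λ l → 0≉1 ∘ sym) (generic⇒δ-distinct third y-generic)

  C-difference∈F : ∀ l → C l - C zero ∈ F
  C-difference∈F zero    = ≈-closed (sym (-‿inverseʳ _)) zero-closed
  C-difference∈F (suc l) = cancel-closed (≉⇒-≉0 (generic⇒distinct y-generic (one≢0 ∘ ≡.sym)))
    (minus-closed (y∈F zero) (y∈F one))
    (≈-closed (*-comm _ _) (differences∈F (λ ()) (one≢0 ∘ ≡.sym)))

  -- Subtracting Σ yₗ(Cₗ - C₀) from Σ yₗCₗ leaves C₀ times the first power sum of the y, which is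
  -- nonzero and in F.
  C-zero∈F : C zero ∈ F
  C-zero∈F = cancel-closed (power-sum≉0 y-generic 0) (sum-closed λ l → mul-closed (y∈F l) one-closed) (≈-closed
    (begin
      (sum λ l → y l * C l) - (sum λ l → y l * (C l - C zero))
        ≈⟨ sum-- (λ l → y l * C l) (λ l → y l * (C l - C zero)) ⟩
      (sum λ l → y l * C l - y l * (C l - C zero))
        ≈⟨ sum-cong-≋ {n} (λ l → trans
             (solve 3 (λ y c d → y :* c :- y :* (c :- d) := d :* y) refl (y l) (C l) (C zero))
             (*-congˡ (sym (*-identityʳ (y l))))) ⟩
      (sum λ l → C zero * y l ^ 1)
        ≈⟨ *-distribˡ-sum (C zero) (λ l → y l ^ 1) ⟨
      C zero * (sum λ l → y l ^ 1) ∎)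
    (minus-closed (permuted-sum∈F Perm.id) (sum-closed λ l → mul-closed (y∈F l) (C-difference∈F l))))

  C∈F : ∀ l → C l ∈ F
  C∈F l = ≈-closed (solve 2 (λ c d → (c :- d) :+ d := c) refl (C l) (C zero)) (add-closed (C-difference∈F l) C-zero∈F)

  -- Here the denominator in `separated` is genuine: `C l` is the quotient of `basis x l i` by
  -- `δ x l`, both polynomial over F in `x l`.
  x∈F : ∀ l → x l ∈ F
  x∈F = separated x esym-x∈F (basis-polynomial x esym-x∈F i) (δ-polynomial x esym-x∈F) C C∈F
    (λ l → sym (C-δ l)) (δ≉0 x x-distinct) C-distinct

  LₛLₜ⊆F : LₛLₜ ⊆ F
  LₛLₜ⊆F = generated-⊆ λ where
      (inj₁ a∈Lₛ) → generated-⊆ (λ { (inj₁ a∈K) → K⊆F a∈K ; (inj₂ (l , a≈x)) → ≈-closed (sym a≈x) (x∈F l) }) a∈Lₛ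
      (inj₂ a∈Lₜ) → generated-⊆ (λ { (inj₁ a∈K) → K⊆F a∈K ; (inj₂ (l , a≈y)) → ≈-closed (sym a≈y) (y∈F l) }) a∈Lₜ

open import Data.Nat.Base using (_+_)

proposition2p5 : ∀ {c ℓ c′ ℓ′} (k : Field c ℓ) (n : ℕ) → 3 ≤ n →
    (E : RationalFunctionField k (n + n) c′ ℓ′) →
    (u : Vector (RationalFunctionField.Carrier E) n) → TwoSets.SolvesSystem n E u →
    (i : Fin n) →
    TwoSets.LₛLₜ n E ≐ Adjoin (RationalFunctionField.L E) (TwoSets.K n E) (TwoSets.Conjugates n E (u i))
proposition2p5 k (suc (suc (suc m))) (s≤s (s≤s (s≤s z≤n))) E u u-solves i =
  LₛLₜ⊆F , λ {a} _ → LₛLₜ-total a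
  where
  open TwoSetsProperties E u u-solves
  open ConjugateField three-elements E u u-solves i
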